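{- Let $\Sigma(\mathsf{o}_{in},\mathsf{o}_{out},\vec a)$ be a $\Delta_0$ formula which implicitly defines $\mathsf{o}_{out}$ as a function of $\mathsf{o}_{in}$. Then there is an $\mathrm{NRC}[\mathrm{get}]$ expression $E$ with free variable $\mathsf{o}_{in}$ such that for all nested relations $\mathsf{o}_{in},\mathsf{o}_{out},\vec a$ of the appropriate types, whenever $\Sigma(\mathsf{o}_{in},\mathsf{o}_{out},\vec a)$ holds, we have $E(\mathsf{o}_{in})=\mathsf{o}_{out}$.
   Context: Types: $T,U ::= \mathsf{Ur}\mid T\times U\mid \mathsf{Unit}\mid \mathsf{Set}(T)$. $\mathsf{Ur}$ is a fixed set of atoms (Ur-elements), $\mathsf{Unit}$ has the single element $\langle\rangle$, $T\times U$ consists of pairs and $\mathsf{Set}(T)$ of all (finite or infinite) sets of elements of $T$. A nested relation of type $T$ is an element of this interpretation. $\Delta_0$ formulas are multi-sorted formulas with typed terms $t::= x\mid\langle\rangle\mid\langle t,u\rangle\mid\pi_1(t)\mid\pi_2(t)$ and formulas built from $t=_{\mathsf{Ur}}t'$, $t\neq_{\mathsf{Ur}}t'$ (only at type $\mathsf{Ur}$), $\top,\bot,\wedge,\vee$ and bounded quantifiers $\forall x\in t\,\varphi$, $\exists x\in t\,\varphi$ (with $t$ of type $\mathsf{Set}(T)$ and $x$ of type $T$); negation is defined by dualizing. They are evaluated on nested relations. A $\Delta_0$ formula $\Sigma(\mathsf{o}_{in},\mathsf{o}_{out},\vec a)$ implicitly defines $\mathsf{o}_{out}$ as a function of $\mathsf{o}_{in}$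 if for any two valuations of $\mathsf{o}_{in},\mathsf{o}_{out},\vec a$ by nested relations (finite or infinite) both satisfying $\Sigma$ and agreeing on $\mathsf{o}_{in}$, they agree on $\mathsf{o}_{out}$. NRC (nested relational calculus) expressions are typed expressions with free variables built from: variables; $\langle\rangle$; pairing $\langle E_1,E_2\rangle$; projections $\pi_1(E),\pi_2(E)$; the empty set $\emptyset$ (of any set type); singleton $\{E\}$; union $E_1\cup E_2$; difference $E_1\setminus E_2$; and $\bigcup\{E_1\mid x\in E_2\}$ (binding $x$; the union over all $x\in E_2$ of $E_1$), with the standard set semantics. $\mathrm{NRC}[\mathrm{get}]$ additionally has, for each type $T$, an operator $\mathrm{get}_T(E)$ for $E$ of type $\mathsf{Set}(T)$, returning the unique element of $E$ if $E$ is a singleton and a fixed default element of $T$ otherwise.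
   Formalization: The set Ur of atoms is assumed infinite; for finite Ur the claim fails, e.g. with two atoms, o_in of type Unit and a formula forcing o_out to be the set of both atoms, which no NRC[get] expression can produce when the defaults involve only one atom. -}

module Defs where

open import Level using (Level; Lift; lift; lower) renaming (zero to lzero; suc to lsuc)
open import Data.Unit using (⊤; tt)
open import Data.Empty using (⊥)
open import Data.Product using (Σ; _×_; _,_; proj₁; proj₂)
open import Data.Sum using (_⊎_)
open import Data.List using (List; []; _∷_)
open import Relation.Binary.PropositionalEquality using (_≡_)
open import Relation.Nullary using (¬_)

infixr 6 _⊗_
data Ty : Set where
  ur   : Ty
  unit : Ty
  _⊗_  : Ty → Ty → Ty
  set  : Ty → Ty

Ctx : Set
Ctx = List Ty

data _∋_ : Ctx → Ty → Set where
  here  : ∀ {Γ T} → (T ∷ Γ) ∋ T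
  there : ∀ {Γ T S} → Γ ∋ T → (S ∷ Γ) ∋ T

infix 3 _iff_
_iff_ : ∀ {a b} → Set a → Set b → Set (a Level.⊔ b)
A iff B = (A → B) × (B → A)

-- Interpretation of types over a fixed set U of Ur-elements.
-- Set(T) is interpreted as ALL subsets of ⟦ T ⟧, i.e. predicates on ⟦ T ⟧
-- that respect (extensional) equality of elements of T.

module Sem (U : Set) where

  ⟦_⟧ : Ty → Set₁
  Eq  : (T : Ty) → ⟦ T ⟧ → ⟦ T ⟧ → Set₁

  ⟦ ur ⟧    = Lift (lsuc lzero) U
  ⟦ unit ⟧  = Lift (lsuc lzero) ⊤
  ⟦ T ⊗ S ⟧ = ⟦ T ⟧ × ⟦ S ⟧
  ⟦ set T ⟧ = Σ (⟦ T ⟧ → Set) (λ P → ∀ x y → Eq T x y → P x → P y)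

  Eq ur a b = Lift (lsuc lzero) (lower a ≡ lower b)
  Eq unit _ _ = Lift (lsuc lzero) ⊤
  Eq (T ⊗ S) (a , b) (c , d) = Eq T a c × Eq S b d
  Eq (set T) (P , _) (Q , _) = ∀ x → P x iff Q x

  _∈_ : ∀ {T} → ⟦ T ⟧ → ⟦ set T ⟧ → Set
  x ∈ s = proj₁ s x

  Env : Ctx → Set₁
  Env []      = Lift (lsuc lzero) ⊤
  Env (T ∷ Γ) = ⟦ T ⟧ × Env Γ

  lookup : ∀ {Γ T} → Env Γ → Γ ∋ T → ⟦ T ⟧
  lookup (v , _) here      = v
  lookup (_ , ρ) (there i) = lookup ρ i

data Tm (Γ : Ctx) : Ty → Set where
  var  : ∀ {T} → Γ ∋ T → Tm Γ T
  ⟨⟩   : Tm Γ unit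
  pair : ∀ {T S} → Tm Γ T → Tm Γ S → Tm Γ (T ⊗ S)
  π₁   : ∀ {T S} → Tm Γ (T ⊗ S) → Tm Γ T
  π₂   : ∀ {T S} → Tm Γ (T ⊗ S) → Tm Γ S

data Δ₀ (Γ : Ctx) : Set where
  eqU  : Tm Γ ur → Tm Γ ur → Δ₀ Γ
  neqU : Tm Γ ur → Tm Γ ur → Δ₀ Γ
  top  : Δ₀ Γ
  bot  : Δ₀ Γ
  and  : Δ₀ Γ → Δ₀ Γ → Δ₀ Γ
  or   : Δ₀ Γ → Δ₀ Γ → Δ₀ Γ
  all  : ∀ {T} → Tm Γ (set T) → Δ₀ (T ∷ Γ) → Δ₀ Γ
  ex   : ∀ {T} → Tm Γ (set T) → Δ₀ (T ∷ Γ) → Δ₀ Γ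

module Δ₀Sem (U : Set) where
  open Sem U

  evalTm : ∀ {Γ T} → Tm Γ T → Env Γ → ⟦ T ⟧
  evalTm (var i)    ρ = lookup ρ i
  evalTm ⟨⟩         ρ = lift tt
  evalTm (pair t s) ρ = evalTm t ρ , evalTm s ρ
  evalTm (π₁ t)     ρ = proj₁ (evalTm t ρ)
  evalTm (π₂ t)     ρ = proj₂ (evalTm t ρ)

  Sat : ∀ {Γ} → Δ₀ Γ → Env Γ → Set₁
  Sat (eqU t s)  ρ = lower (evalTm t ρ) ≡ lower (evalTm s ρ) × Lift _ ⊤
  Sat (neqU t s) ρ = ¬ (lower (evalTm t ρ) ≡ lower (evalTm s ρ)) × Lift _ ⊤
  Sat top        ρ = Lift _ ⊤
  Sat bot        ρ = Lift _ ⊥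
  Sat (and φ ψ)  ρ = Sat φ ρ × Sat ψ ρ
  Sat (or φ ψ)   ρ = Sat φ ρ ⊎ Sat ψ ρ
  Sat (all t φ)  ρ = ∀ x → x ∈ evalTm t ρ → Sat φ (x , ρ)
  Sat (ex t φ)   ρ = Σ _ (λ x → x ∈ evalTm t ρ × Sat φ (x , ρ))

  -- Σ(o_in , o_out , a⃗) implicitly defines o_out as a function of o_in
  -- (over all nested relations, finite or infinite, over U)
  ImplicitlyDefines : ∀ {Tin Tout As} → Δ₀ (Tin ∷ Tout ∷ As) → Set₁
  ImplicitlyDefines {Tin} {Tout} {As} φ =
    ∀ (i : ⟦ Tin ⟧) (o o′ : ⟦ Tout ⟧) (a a′ : Env As) →
      Sat φ (i , o , a) → Sat φ (i , o′ , a′) → Eq Tout o o′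

data NRC (Γ : Ctx) : Ty → Set where
  var  : ∀ {T} → Γ ∋ T → NRC Γ T
  ⟨⟩   : NRC Γ unit
  pair : ∀ {T S} → NRC Γ T → NRC Γ S → NRC Γ (T ⊗ S)
  π₁   : ∀ {T S} → NRC Γ (T ⊗ S) → NRC Γ T
  π₂   : ∀ {T S} → NRC Γ (T ⊗ S) → NRC Γ S
  ∅    : ∀ {T} → NRC Γ (set T)
  sng  : ∀ {T} → NRC Γ T → NRC Γ (set T)
  union : ∀ {T} → NRC Γ (set T) → NRC Γ (set T) → NRC Γ (set T)
  diff  : ∀ {T} → NRC Γ (set T) → NRC Γ (set T) → NRC Γ (set T)
  bigU : ∀ {T S} → NRC (T ∷ Γ) (set S) → NRC Γ (set T) → NRC Γ (set S)
  get  : ∀ {T} → NRC Γ (set T) → NRC Γ T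

-- Standard set semantics, given as a (functional up to Eq) big-step
-- relation  Eval E ρ v  : "E evaluates to v under ρ".  dflt T is the
-- fixed default element of T returned by get_T on non-singletons.
module NRCEval (U : Set) where
  open Sem U

  IsSingletonOf : ∀ {T} → ⟦ set T ⟧ → ⟦ T ⟧ → Set₁
  IsSingletonOf {T} s w = ∀ x → Lift (lsuc lzero) (x ∈ s) iff Eq T w x

  Eval : (dflt : (T : Ty) → ⟦ T ⟧) → ∀ {Γ T} → NRC Γ T → Env Γ → ⟦ T ⟧ → Set₁
  Eval d {T = T} (var i) ρ v = Eq T (lookup ρ i) v
  Eval d ⟨⟩ ρ v = Eq unit (lift tt) v
  Eval d (pair E F) ρ (v , w) = Eval d E ρ v × Eval d F ρ w
  Eval d (π₁ E) ρ v = Σ _ (λ w → Eval d E ρ (v , w))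
  Eval d (π₂ E) ρ v = Σ _ (λ w → Eval d E ρ (w , v))
  Eval d ∅ ρ v = ∀ x → ¬ (x ∈ v) × Lift (lsuc lzero) ⊤
  Eval d (sng E) ρ v = Σ _ (λ w → Eval d E ρ w × IsSingletonOf v w)
  Eval d (union E F) ρ v =
    Σ _ (λ v₁ → Σ _ (λ v₂ → Eval d E ρ v₁ × Eval d F ρ v₂ ×
      (∀ x → Lift (lsuc lzero) ((x ∈ v) iff ((x ∈ v₁) ⊎ (x ∈ v₂))))))
  Eval d (diff E F) ρ v =
    Σ _ (λ v₁ → Σ _ (λ v₂ → Eval d E ρ v₁ × Eval d F ρ v₂ ×
      (∀ x → Lift (lsuc lzero) ((x ∈ v) iff ((x ∈ v₁) × ¬ (x ∈ v₂))))))
  Eval d (bigU E F) ρ v =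
    Σ _ (λ s → Eval d F ρ s ×
      (∀ y → Lift (lsuc lzero) (y ∈ v) iff
        Σ _ (λ x → Lift (lsuc lzero) (x ∈ s) ×
          Σ _ (λ w → Eval d E (x , ρ) w × Lift (lsuc lzero) (y ∈ w)))))
  Eval d {T = T} (get E) ρ v =
    Σ _ (λ s → Eval d E ρ s ×
      ((Σ _ (λ w → IsSingletonOf s w × Eq T w v))
       ⊎ ((¬ Σ _ (λ w → IsSingletonOf s w)) × Eq T (d T) v)))

module Submission where

open import Defs
open import Level using (0ℓ; Lift; lift; lower) renaming (suc to lsuc)
open import Axiom.ExcludedMiddle using (ExcludedMiddle)
open import Data.Bool using (Bool; true; false)
open import Data.Empty using (⊥; ⊥-elim)
open import Data.Fin using (toℕ)
open import Data.List using (List; []; _∷_; _++_)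
open import Data.List.Membership.Propositional using () renaming (_∈_ to _∈ₗ_)
open import Data.List.Membership.Propositional.Properties using (∈-++⁺ˡ; ∈-++⁺ʳ)
open import Data.List.Relation.Unary.Any using (here; there; index)
open import Data.Maybe using (Maybe; just; nothing; fromMaybe)
open import Data.Nat using (ℕ; zero; suc; _≤_; _<_; _⊔_; _+_; _≤′_; ≤′-refl; ≤′-step; z≤n; s≤s)
open import Data.Nat.Properties
open import Data.Product using (Σ; ∃; _×_; _,_; proj₁; proj₂)
open import Data.Sum using (_⊎_; inj₁; inj₂; [_,_]′)
open import Data.Unit using (⊤; tt)
open import Function.Bundles using (_↣_; Injection)
open import Relation.Binary.PropositionalEquality hiding ([_])
open import Relation.Nullary using (¬_; yes; no)

-- Let φL and φR be formulas sharing the variables Γ, and x a variable of φL.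
-- Call (φL , φR) separated if some NRC condition θ and expression E over Γ satisfy
-- φL ⊨ θ ∨ x ∈ E and φR ⊨ ¬ θ.  From an inseparable pair, a Henkin construction
-- yields two theories, one per side, which are interpreted as nested relations over
-- countably many atoms by a Mostowski collapse.  Each element of a common set is made
-- equal to a new common variable, so the two collapses agree on Γ; and the inseparability
-- is used to keep x different from every element named on the right.  Hence, if
-- φL ∧ φR ⊨ x ∈ b, then x ∈ E for some E over Γ: for atoms E collects common atoms, and
-- for x of type set S one first obtains, by induction on types, a common c ⊇ x and then
-- compares x with the subsets of c definable by NRC conditions.  Taking φL and φR to be
-- two copies of an implicit definition of o, this gives E ∋ o, and o is the unique
-- element of E that satisfies an interpolant of φ(i,o,a) and φ(i,o′,a′) ∧ o ≠ o′.

-- No proof calculus is involved: a theory is a predicate on valuations over `U`, and entailment is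
-- truth at all its valuations. The obstacle is the lack of compactness. Every stage of the
-- construction is consistent, but no single valuation need satisfy all stages, so the limit model
-- cannot be picked among the valuations. It is rebuilt from terms: an equality or membership
-- between terms counts as true if some stage entails it. There are countably many terms, whence an
-- injection of `ℕ` into `U` provides enough atoms. These fall into three disjoint classes: atoms
-- with a common name, atoms of the left alone, atoms of the right alone; an atom of the left
-- without a common name is therefore absent from the right. A separation at a late stage mentions
-- the new common variables. Each of them is eliminated by a quantifier over a common set, or over
-- the singleton of a default element, and the covering expression `E` is replaced by its union over
-- that set. This is why all common witnesses are sought inside common sets.

-- Δ₀ formulas with equality and membership atoms at every type.  Weakening is
-- a constructor, so that no renaming lemmas are needed.
data Fm : Ctx → Set where
  eq  : ∀ {Γ T} → Tm Γ T → Tm Γ T → Fm Γ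
  neq : ∀ {Γ T} → Tm Γ T → Tm Γ T → Fm Γ
  mem : ∀ {Γ T} → Tm Γ T → Tm Γ (set T) → Fm Γ
  and : ∀ {Γ} → Fm Γ → Fm Γ → Fm Γ
  or  : ∀ {Γ} → Fm Γ → Fm Γ → Fm Γ
  all : ∀ {Γ T} → Tm Γ (set T) → Fm (T ∷ Γ) → Fm Γ
  ex  : ∀ {Γ T} → Tm Γ (set T) → Fm (T ∷ Γ) → Fm Γ
  wk  : ∀ {Γ T} → Fm Γ → Fm (T ∷ Γ)

fromΔ₀ : ∀ {Γ} → Δ₀ Γ → Fm Γ
fromΔ₀ (eqU t s)  = eq t s
fromΔ₀ (neqU t s) = neq t s
fromΔ₀ top        = eq ⟨⟩ ⟨⟩
fromΔ₀ bot        = neq ⟨⟩ ⟨⟩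
fromΔ₀ (and φ ψ)  = and (fromΔ₀ φ) (fromΔ₀ ψ)
fromΔ₀ (or φ ψ)   = or (fromΔ₀ φ) (fromΔ₀ ψ)
fromΔ₀ (all t φ)  = all t (fromΔ₀ φ)
fromΔ₀ (ex t φ)   = ex t (fromΔ₀ φ)

-- Only instances of formulas in such a list are ever decided, so a formula can be coded by its
-- position in the list.
subformulas : ∀ {Γ} → Fm Γ → List (Σ Ctx Fm)
proper : ∀ {Γ} → Fm Γ → List (Σ Ctx Fm)
subformulas A = (_ , A) ∷ proper A
proper (eq t s)  = []
proper (neq t s) = []
proper (mem t s) = []
proper (and A B) = subformulas A ++ subformulas B
proper (or A B)  = subformulas A ++ subformulas B
proper (all t A) = subformulas A
proper (ex t A)  = subformulas A
proper (wk A)    = subformulas A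

-- Coding by natural numbers

-- The successor step of Cantor's enumeration along the diagonals of constant sum. The pairing `pr`
-- is read off from surjectivity of the enumeration, and is injective because `unpair` is its left
-- inverse.
next : ℕ × ℕ → ℕ × ℕ
next (zero  , b) = suc b , zero
next (suc a , b) = a , suc b

unpair : ℕ → ℕ × ℕ
unpair zero    = zero , zero
unpair (suc n) = next (unpair n)

unpair-surjective : ∀ a b → ∃ λ n → unpair n ≡ (a , b)
unpair-surjective a b = go (a + b) a b refl
  where
  go : ∀ s a b → a + b ≡ s → ∃ λ n → unpair n ≡ (a , b)
  go zero zero zero _ = zero , refl
  go (suc s) (suc a) zero e with go s zero a (trans (sym (+-identityʳ a)) (suc-injective e))
  ... | n , p = suc n , cong next p
  go s a (suc b) e with go s (suc a) b (trans (sym (+-suc a b)) e)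
  ... | n , p = suc n , cong next p

-- For fairness of the schedule: a number stored inside a code is a lower bound for the code.
unpair-≤ : ∀ n → proj₁ (unpair n) ≤ n × proj₂ (unpair n) ≤ n
unpair-≤ zero = z≤n , z≤n
unpair-≤ (suc n) with unpair n | unpair-≤ n
... | zero  , b | _ , q = s≤s q , z≤n
... | suc a , b | p , q = ≤-trans (n≤1+n a) (m≤n⇒m≤1+n p) , s≤s q

pr : ℕ → ℕ → ℕ
pr a b = proj₁ (unpair-surjective a b)

unpair-pr : ∀ a b → unpair (pr a b) ≡ (a , b)
unpair-pr a b = proj₂ (unpair-surjective a b)

pr-injective : ∀ {a b c d} → pr a b ≡ pr c d → (a , b) ≡ (c , d)
pr-injective {a} {b} {c} {d} e = trans (sym (unpair-pr a b)) (trans (cong unpair e) (unpair-pr c d))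

-- An untyped intermediate form for codes of typed syntax. Types hidden in a constructor, such as
-- the other component under a projection, are stored in the tree, so injectivity is a structural
-- induction.
data Tree : Set where
  leaf : Tree
  node : ℕ → Tree → Tree → Tree

node-inj₀ : ∀ {m n a b c d} → node m a b ≡ node n c d → m ≡ n
node-inj₀ refl = refl

node-inj₁ : ∀ {m n a b c d} → node m a b ≡ node n c d → a ≡ c
node-inj₁ refl = refl

node-inj₂ : ∀ {m n a b c d} → node m a b ≡ node n c d → b ≡ d
node-inj₂ refl = refl

⌜_⌝ : Tree → ℕ
⌜ leaf ⌝       = zero
⌜ node n a b ⌝ = suc (pr n (pr ⌜ a ⌝ ⌜ b ⌝))

⌜⌝-injective : ∀ a b → ⌜ a ⌝ ≡ ⌜ b ⌝ → a ≡ b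
⌜⌝-injective leaf leaf _ = refl
⌜⌝-injective (node m a b) (node n c d) e
  with e₁ ← pr-injective {m} {_} {n} (suc-injective e)
  with e₂ ← pr-injective {⌜ a ⌝} {_} {⌜ c ⌝} (cong proj₂ e₁)
  rewrite cong proj₁ e₁ | ⌜⌝-injective a c (cong proj₁ e₂) | ⌜⌝-injective b d (cong proj₂ e₂) = refl

codeTy : Ty → Tree
codeTy ur      = node 0 leaf leaf
codeTy unit    = node 1 leaf leaf
codeTy (T ⊗ S) = node 2 (codeTy T) (codeTy S)
codeTy (set T) = node 3 (codeTy T) leaf

codeTy-injective : ∀ T S → codeTy T ≡ codeTy S → T ≡ S
codeTy-injective ur ur _ = refl
codeTy-injective unit unit _ = refl
codeTy-injective (T ⊗ S) (T′ ⊗ S′) e =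
  cong₂ _⊗_ (codeTy-injective T T′ (node-inj₁ e)) (codeTy-injective S S′ (node-inj₂ e))
codeTy-injective (set T) (set S) e = cong set (codeTy-injective T S (node-inj₁ e))

codeVar : ∀ {Γ T} → Γ ∋ T → Tree
codeVar here      = leaf
codeVar (there i) = node 0 (codeVar i) leaf

codeVar-injective : ∀ {Γ T} (i j : Γ ∋ T) → codeVar i ≡ codeVar j → i ≡ j
codeVar-injective here here _ = refl
codeVar-injective (there i) (there j) e = cong there (codeVar-injective i j (node-inj₁ e))

-- NRC conditions, with truth values the subsets of the unit type

notB : ∀ {Γ} → NRC Γ (set unit) → NRC Γ (set unit)
notB θ = diff (sng ⟨⟩) θ

anyB : ∀ {Γ T} → NRC Γ (set T) → NRC (T ∷ Γ) (set unit) → NRC Γ (set unit)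
anyB c θ = bigU θ c

allB : ∀ {Γ T} → NRC Γ (set T) → NRC (T ∷ Γ) (set unit) → NRC Γ (set unit)
allB c θ = notB (bigU (notB θ) c)

-- Intersection, obtained from difference alone.
andB : ∀ {Γ} → NRC Γ (set unit) → NRC Γ (set unit) → NRC Γ (set unit)
andB θ θ′ = diff θ (diff θ θ′)

-- Equality at every type: u = w exactly when {u} minus {w} is empty.
eqB : ∀ {Γ T} → NRC Γ T → NRC Γ T → NRC Γ (set unit)
eqB u w = notB (bigU (sng ⟨⟩) (diff (sng u) (sng w)))

-- A union indexed by a truth value is a conditional: the inner `bigU` is {x} if `θ` holds and empty
-- otherwise.
filter : ∀ {Γ T} → NRC Γ (set T) → NRC (T ∷ Γ) (set unit) → NRC Γ (set T)
filter c θ = bigU (bigU (sng (var (there here))) θ) c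

-- Consequences of excluded middle

module Classical (em₀ : ExcludedMiddle 0ℓ) (em₁ : ExcludedMiddle (lsuc 0ℓ)) where

  stable : {P : Set₁} → ¬ ¬ P → P
  stable {P} nn with em₁ {P}
  ... | yes p = p
  ... | no ¬p = ⊥-elim (nn ¬p)

  -- Sets are `Set`-valued predicates, whereas the semantics and entailment live in `Set₁`; excluded
  -- middle brings a `Set₁` proposition down to an equivalent small one.
  Small : Set₁ → Set
  Small P with em₁ {P}
  ... | yes _ = ⊤
  ... | no _  = ⊥

  toSmall : {P : Set₁} → P → Small P
  toSmall {P} p with em₁ {P}
  ... | yes _ = tt
  ... | no ¬p = ⊥-elim (¬p p)

  fromSmall : {P : Set₁} → Small P → P
  fromSmall {P} s with em₁ {P}
  ... | yes p = p
  ... | no _  = ⊥-elim s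

  Least : (ℕ → Set₁) → ℕ → Set₁
  Least P n = P n × (∀ m → P m → n ≤ m)

  least : (P : ℕ → Set₁) → ∀ {n} → P n → ∃ (Least P)
  least P {n} p with em₁ {P 0}
  ... | yes p₀ = 0 , p₀ , λ _ _ → z≤n
  least P {zero} p  | no ¬p₀ = ⊥-elim (¬p₀ p)
  least P {suc n} p | no ¬p₀ with least (λ m → P (suc m)) p
  ... | m , q , min = suc m , q , λ { zero r → ⊥-elim (¬p₀ r) ; (suc i) r → s≤s (min i r) }

  least-unique : ∀ {P Q : ℕ → Set₁} {m n} → (∀ i → P i → Q i) → (∀ i → Q i → P i) →
    Least P m → Least Q n → m ≡ n
  least-unique pq qp (p , minP) (q , minQ) = ≤-antisym (minP _ (qp _ q)) (minQ _ (pq _ p))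

  decode : {A : Set} → (A → ℕ) → ℕ → Maybe A
  decode {A} code n with em₀ {Σ A (λ a → code a ≡ n)}
  ... | yes (a , _) = just a
  ... | no _        = nothing

  decode-code : {A : Set} (code : A → ℕ) → (∀ a b → code a ≡ code b → a ≡ b) →
    ∀ a → decode code (code a) ≡ just a
  decode-code {A} code inj a with em₀ {Σ A (λ b → code b ≡ code a)}
  ... | yes (b , e) = cong just (inj b a e)
  ... | no ¬p       = ⊥-elim (¬p (a , refl))

-- Classical semantics of formulas and expressions

module Semantics (em₀ : ExcludedMiddle 0ℓ) (em₁ : ExcludedMiddle (lsuc 0ℓ))
                 (U : Set) (dflt : (T : Ty) → Sem.⟦_⟧ U T) where
  open Classical em₀ em₁ public
  open Sem U public
  open Δ₀Sem U public
  open NRCEval U public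

  Eq-refl : ∀ T {x} → Eq T x x
  Eq-refl ur      = lift refl
  Eq-refl unit    = lift tt
  Eq-refl (T ⊗ S) = Eq-refl T , Eq-refl S
  Eq-refl (set T) = λ _ → (λ p → p) , (λ p → p)

  Eq-sym : ∀ T {x y} → Eq T x y → Eq T y x
  Eq-sym ur (lift e)       = lift (sym e)
  Eq-sym unit _            = lift tt
  Eq-sym (T ⊗ S) (p , q)   = Eq-sym T p , Eq-sym S q
  Eq-sym (set T) e         = λ x → proj₂ (e x) , proj₁ (e x)

  Eq-trans : ∀ T {x y z} → Eq T x y → Eq T y z → Eq T x z
  Eq-trans ur (lift e) (lift f)        = lift (trans e f)
  Eq-trans unit _ _                    = lift tt
  Eq-trans (T ⊗ S) (p , q) (p′ , q′)   = Eq-trans T p p′ , Eq-trans S q q′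
  Eq-trans (set T) e f                 = λ x → (λ p → proj₁ (f x) (proj₁ (e x) p)) , (λ p → proj₂ (e x) (proj₂ (f x) p))

  ∈-resp : ∀ {T} {x y : ⟦ T ⟧} {s t : ⟦ set T ⟧} → Eq T x y → Eq (set T) s t → x ∈ s → y ∈ t
  ∈-resp {s = s} {t} e f p = proj₁ (f _) (proj₂ s _ _ e p)

  ≡⇒Eq : ∀ {T} {x y : ⟦ T ⟧} → x ≡ y → Eq T x y
  ≡⇒Eq {T} refl = Eq-refl T

  univ : ∀ {T} → ⟦ set T ⟧
  univ = (λ _ → ⊤) , (λ _ _ _ p → p)

  SatF : ∀ {Γ} → Fm Γ → Env Γ → Set₁
  SatF (eq {T = T} t s) ρ  = Eq T (evalTm t ρ) (evalTm s ρ)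
  SatF (neq {T = T} t s) ρ = ¬ Eq T (evalTm t ρ) (evalTm s ρ)
  SatF (mem t s) ρ = Lift _ (evalTm t ρ ∈ evalTm s ρ)
  SatF (and A B) ρ = SatF A ρ × SatF B ρ
  SatF (or A B) ρ  = SatF A ρ ⊎ SatF B ρ
  SatF (all t A) ρ = ∀ x → x ∈ evalTm t ρ → SatF A (x , ρ)
  SatF (ex t A) ρ  = Σ _ (λ x → x ∈ evalTm t ρ × SatF A (x , ρ))
  SatF (wk A) (_ , ρ) = SatF A ρ

  fromSat : ∀ {Γ} (φ : Δ₀ Γ) {ρ} → Sat φ ρ → SatF (fromΔ₀ φ) ρ
  fromSat (eqU t s) (e , _)  = lift e
  fromSat (neqU t s) (n , _) = λ e → n (lower e)
  fromSat top _              = lift tt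
  fromSat (and φ ψ) (p , q)  = fromSat φ p , fromSat ψ q
  fromSat (or φ ψ) (inj₁ p)  = inj₁ (fromSat φ p)
  fromSat (or φ ψ) (inj₂ p)  = inj₂ (fromSat ψ p)
  fromSat (all t φ) p        = λ x m → fromSat φ (p x m)
  fromSat (ex t φ) (x , m , p) = x , m , fromSat φ p

  toSat : ∀ {Γ} (φ : Δ₀ Γ) {ρ} → SatF (fromΔ₀ φ) ρ → Sat φ ρ
  toSat (eqU t s) e        = lower e , lift tt
  toSat (neqU t s) n       = (λ e → n (lift e)) , lift tt
  toSat top _              = lift tt
  toSat bot p              = ⊥-elim (p (lift tt))
  toSat (and φ ψ) (p , q)  = toSat φ p , toSat ψ q
  toSat (or φ ψ) (inj₁ p)  = inj₁ (toSat φ p)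
  toSat (or φ ψ) (inj₂ p)  = inj₂ (toSat ψ p)
  toSat (all t φ) p        = λ x m → toSat φ (p x m)
  toSat (ex t φ) (x , m , p) = x , m , toSat φ p

  EqEnv : ∀ {Γ} → Env Γ → Env Γ → Set₁
  EqEnv {Γ} ρ ρ′ = ∀ {T} (i : Γ ∋ T) → Eq T (lookup ρ i) (lookup ρ′ i)

  EqEnv-∷ : ∀ {Γ T} {x y : ⟦ T ⟧} {ρ ρ′ : Env Γ} → Eq T x y → EqEnv ρ ρ′ → EqEnv {T ∷ Γ} (x , ρ) (y , ρ′)
  EqEnv-∷ e es here      = e
  EqEnv-∷ e es (there i) = es i

  evalTm-cong : ∀ {Γ T} (t : Tm Γ T) {ρ ρ′} → EqEnv ρ ρ′ → Eq T (evalTm t ρ) (evalTm t ρ′)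
  evalTm-cong (var i) e    = e i
  evalTm-cong ⟨⟩ e         = lift tt
  evalTm-cong (pair t s) e = evalTm-cong t e , evalTm-cong s e
  evalTm-cong (π₁ t) e     = proj₁ (evalTm-cong t e)
  evalTm-cong (π₂ t) e     = proj₂ (evalTm-cong t e)

  Eq-cong : ∀ T {x x′ y y′} → Eq T x x′ → Eq T y y′ → Eq T x y → Eq T x′ y′
  Eq-cong T p q e = Eq-trans T (Eq-sym T p) (Eq-trans T e q)

  SatF-cong : ∀ {Γ} (A : Fm Γ) {ρ ρ′} → EqEnv ρ ρ′ → SatF A ρ → SatF A ρ′
  SatF-cong (eq {T = T} t s) e p  = Eq-cong T (evalTm-cong t e) (evalTm-cong s e) p
  SatF-cong (neq {T = T} t s) e p = λ q → p (Eq-cong T (Eq-sym T (evalTm-cong t e)) (Eq-sym T (evalTm-cong s e)) q)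
  SatF-cong (mem {T = T} t s) {ρ} {ρ′} e (lift p) =
    lift (∈-resp {s = evalTm s ρ} {evalTm s ρ′} (evalTm-cong t e) (evalTm-cong s e) p)
  SatF-cong (and A B) e (p , q)   = SatF-cong A e p , SatF-cong B e q
  SatF-cong (or A B) e (inj₁ p)   = inj₁ (SatF-cong A e p)
  SatF-cong (or A B) e (inj₂ p)   = inj₂ (SatF-cong B e p)
  SatF-cong (all {T = T} t A) e p = λ x m →
    SatF-cong A (EqEnv-∷ (Eq-refl T) e) (p x (proj₂ (evalTm-cong t e x) m))
  SatF-cong (ex {T = T} t A) e (x , m , p) =
    x , proj₁ (evalTm-cong t e x) m , SatF-cong A (EqEnv-∷ (Eq-refl T) e) p
  SatF-cong (wk A) e p = SatF-cong A (λ i → e (there i)) p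

  -- Excluded middle turns the big-step relation `Eval` into a function, so that separations can
  -- speak of the value of an expression.
  ev : ∀ {Γ T} → NRC Γ T → Env Γ → ⟦ T ⟧
  ev (var i) ρ    = lookup ρ i
  ev ⟨⟩ ρ         = lift tt
  ev (pair E F) ρ = ev E ρ , ev F ρ
  ev (π₁ E) ρ     = proj₁ (ev E ρ)
  ev (π₂ E) ρ     = proj₂ (ev E ρ)
  ev ∅ ρ          = (λ _ → ⊥) , (λ _ _ _ p → p)
  ev (sng {T} E) ρ = (λ x → Small (Eq T (ev E ρ) x)) , λ x y e p → toSmall (Eq-trans T (fromSmall p) e)
  ev (union E F) ρ = (λ x → (x ∈ ev E ρ) ⊎ (x ∈ ev F ρ)) ,
    λ x y e → λ { (inj₁ p) → inj₁ (proj₂ (ev E ρ) x y e p) ; (inj₂ p) → inj₂ (proj₂ (ev F ρ) x y e p) }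
  ev (diff {T} E F) ρ = (λ x → (x ∈ ev E ρ) × ¬ (x ∈ ev F ρ)) ,
    λ x y e (p , n) → proj₂ (ev E ρ) x y e p , λ q → n (proj₂ (ev F ρ) y x (Eq-sym T e) q)
  ev (bigU E F) ρ = (λ y → Small (Σ _ λ x → (x ∈ ev F ρ) × (y ∈ ev E (x , ρ)))) ,
    λ y z e p → let (x , m , q) = fromSmall p in toSmall (x , m , proj₂ (ev E (x , ρ)) y z e q)
  ev (get {T} E) ρ with em₁ {Σ _ (IsSingletonOf (ev E ρ))}
  ... | yes (w , _) = w
  ... | no _        = dflt T

  IsSingletonOf-cong : ∀ {T} {s s′ : ⟦ set T ⟧} {w w′} → Eq (set T) s s′ → Eq T w w′ →
    IsSingletonOf s w → IsSingletonOf s′ w′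
  IsSingletonOf-cong {T} e f h x =
    (λ p → Eq-trans T (Eq-sym T f) (proj₁ (h x) (lift (proj₂ (e x) (lower p))))) ,
    (λ q → lift (proj₁ (e x) (lower (proj₂ (h x) (Eq-trans T f q)))))

  singleton-unique : ∀ {T} {s : ⟦ set T ⟧} {w w′} → IsSingletonOf s w → IsSingletonOf s w′ → Eq T w w′
  singleton-unique {T} h h′ = proj₁ (h _) (proj₂ (h′ _) (Eq-refl T))

  -- The two directions are mutual because `Eval` of `bigU` admits any value of the body, not only
  -- the one computed by `ev`.
  ev-sound : ∀ {Γ T} (E : NRC Γ T) ρ v → Eq T (ev E ρ) v → Eval dflt E ρ v
  ev-complete : ∀ {Γ T} (E : NRC Γ T) ρ v → Eval dflt E ρ v → Eq T (ev E ρ) v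
  ev-self : ∀ {Γ T} (E : NRC Γ T) ρ → Eval dflt E ρ (ev E ρ)
  ev-self {T = T} E ρ = ev-sound E ρ (ev E ρ) (Eq-refl T)

  ev-sound (var i) ρ v e = e
  ev-sound ⟨⟩ ρ v e = e
  ev-sound (pair E F) ρ (v , w) (e , f) = ev-sound E ρ v e , ev-sound F ρ w f
  ev-sound (π₁ {T} {S} E) ρ v e = proj₂ (ev E ρ) , ev-sound E ρ _ (e , Eq-refl S)
  ev-sound (π₂ {T} {S} E) ρ v e = proj₁ (ev E ρ) , ev-sound E ρ _ (Eq-refl T , e)
  ev-sound ∅ ρ v e x = proj₂ (e x) , lift tt
  ev-sound (sng {T} E) ρ v e = ev E ρ , ev-self E ρ ,
    λ x → (λ p → fromSmall (proj₂ (e x) (lower p))) , (λ q → lift (proj₁ (e x) (toSmall q)))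
  ev-sound (union {T} E F) ρ v e = ev E ρ , ev F ρ , ev-self E ρ , ev-self F ρ ,
    λ x → lift (proj₂ (e x) , proj₁ (e x))
  ev-sound (diff {T} E F) ρ v e = ev E ρ , ev F ρ , ev-self E ρ , ev-self F ρ ,
    λ x → lift (proj₂ (e x) , proj₁ (e x))
  ev-sound (bigU {T} {S} E F) ρ v e = ev F ρ , ev-self F ρ , λ y →
    (λ p → let (x , m , q) = fromSmall (proj₂ (e y) (lower p)) in
       x , lift m , ev E (x , ρ) , ev-self E (x , ρ) , lift q) ,
    λ (x , m , w , h , q) → lift (proj₁ (e y) (toSmall (x , lower m , proj₂ (ev-complete E (x , ρ) w h y) (lower q))))
  ev-sound (get {T} E) ρ v e with em₁ {Σ _ (IsSingletonOf (ev E ρ))}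
  ... | yes (w , h) = ev E ρ , ev-self E ρ , inj₁ (w , h , e)
  ... | no n        = ev E ρ , ev-self E ρ , inj₂ (n , e)

  ev-complete (var i) ρ v h = h
  ev-complete ⟨⟩ ρ v h = h
  ev-complete (pair E F) ρ (v , w) (h , k) = ev-complete E ρ v h , ev-complete F ρ w k
  ev-complete (π₁ E) ρ v (w , h) = proj₁ (ev-complete E ρ _ h)
  ev-complete (π₂ E) ρ v (w , h) = proj₂ (ev-complete E ρ _ h)
  ev-complete ∅ ρ v h x = ⊥-elim , proj₁ (h x)
  ev-complete (sng {T} E) ρ v (w , h , k) x =
    (λ p → lower (proj₂ (k x) (Eq-trans T (Eq-sym T (ev-complete E ρ w h)) (fromSmall p)))) ,
    (λ p → toSmall (Eq-trans T (ev-complete E ρ w h) (proj₁ (k x) (lift p))))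
  ev-complete (union E F) ρ v (a , b , h , k , l) x =
    (λ { (inj₁ p) → proj₂ (lower (l x)) (inj₁ (proj₁ (ev-complete E ρ a h x) p))
       ; (inj₂ p) → proj₂ (lower (l x)) (inj₂ (proj₁ (ev-complete F ρ b k x) p)) }) ,
    λ p → [ (λ q → inj₁ (proj₂ (ev-complete E ρ a h x) q)) , (λ q → inj₂ (proj₂ (ev-complete F ρ b k x) q)) ]′
            (proj₁ (lower (l x)) p)
  ev-complete (diff E F) ρ v (a , b , h , k , l) x =
    (λ (p , n) → proj₂ (lower (l x)) (proj₁ (ev-complete E ρ a h x) p , λ q → n (proj₂ (ev-complete F ρ b k x) q))) ,
    λ p → let (q , n) = proj₁ (lower (l x)) p in
      proj₂ (ev-complete E ρ a h x) q , λ r → n (proj₁ (ev-complete F ρ b k x) r)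
  ev-complete (bigU {T} {S} E F) ρ v (s , h , k) y =
    (λ p → let (x , m , q) = fromSmall p in
       lower (proj₂ (k y) (x , lift (proj₁ (ev-complete F ρ s h x) m) , ev E (x , ρ) ,
         ev-self E (x , ρ) , lift q))) ,
    λ p → let (x , m , w , g , q) = proj₁ (k y) (lift p) in
      toSmall (x , proj₂ (ev-complete F ρ s h x) (lower m) , proj₂ (ev-complete E (x , ρ) w g y) (lower q))
  ev-complete (get {T} E) ρ v (s , h , r) with em₁ {Σ _ (IsSingletonOf (ev E ρ))} | ev-complete E ρ s h
  ev-complete (get {T} E) ρ v (s , h , inj₁ (w , k , e)) | yes (w′ , k′) | c =
    Eq-trans T (singleton-unique {s = s} (IsSingletonOf-cong {s = ev E ρ} {s} c (Eq-refl T) k′) k) e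
  ev-complete (get {T} E) ρ v (s , h , inj₂ (n , e)) | yes (w′ , k′) | c =
    ⊥-elim (n (w′ , IsSingletonOf-cong {s = ev E ρ} {s} c (Eq-refl T) k′))
  ev-complete (get {T} E) ρ v (s , h , inj₁ (w , k , e)) | no n | c =
    ⊥-elim (n (w , IsSingletonOf-cong {s = s} {ev E ρ} (Eq-sym (set T) {ev E ρ} {s} c) (Eq-refl T) k))
  ev-complete (get {T} E) ρ v (s , h , inj₂ (_ , e)) | no n | c = e

  Holds : ∀ {Γ} → NRC Γ (set unit) → Env Γ → Set
  Holds θ ρ = _∈_ {unit} (lift tt) (ev θ ρ)

-- Henkin terms and their codes

index-injective : ∀ {A : Set} {xs : List A} {x y} (p : x ∈ₗ xs) (q : y ∈ₗ xs) →
  toℕ (index p) ≡ toℕ (index q) → _≡_ {A = Σ A (_∈ₗ xs)} (x , p) (y , q)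
index-injective (here refl) (here refl) _ = refl
index-injective (there p) (there q) e with index-injective p q (suc-injective e)
... | refl = refl

codeBool : Bool → Tree
codeBool true  = leaf
codeBool false = node 0 leaf leaf

codeBool-injective : ∀ b c → codeBool b ≡ codeBool c → b ≡ c
codeBool-injective true true _   = refl
codeBool-injective false false _ = refl

module Common (τ : ℕ → Ty) (Γ : Ctx) where

  ctx : ℕ → Ctx
  ctx zero    = Γ
  ctx (suc k) = τ k ∷ ctx k

  weaken : ∀ {T} k → Γ ∋ T → ctx k ∋ T
  weaken zero i    = i
  weaken (suc k) i = there (weaken k i)

  position : ∀ {n k} → suc n ≤′ k → ctx k ∋ τ n
  position ≤′-refl     = here
  position (≤′-step p) = there (position p)

  -- Common names. Projections are included because the collapse of a term of product type is formed
  -- from its projections.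
  data CT : Ty → Set where
    base : ∀ {T} → Γ ∋ T → CT T
    new  : ∀ {T} n → τ n ≡ T → CT T
    π₁   : ∀ {T S} → CT (T ⊗ S) → CT T
    π₂   : ∀ {T S} → CT (T ⊗ S) → CT S

  -- The stage from which the term lies over `ctx k`: variable n enters only in `ctx (suc n)`.
  boundC : ∀ {T} → CT T → ℕ
  boundC (base i)  = 0
  boundC (new n _) = suc n
  boundC (π₁ w)    = boundC w
  boundC (π₂ w)    = boundC w

  toNRC : ∀ {T} (w : CT T) {k} → boundC w ≤ k → NRC (ctx k) T
  toNRC (base i) {k} p   = var (weaken k i)
  toNRC (new n refl) p   = var (position (≤⇒≤′ p))
  toNRC (π₁ w) p         = π₁ (toNRC w p)
  toNRC (π₂ w) p         = π₂ (toNRC w p)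

  codeC : ∀ {T} → CT T → Tree
  codeC (base i)       = node 0 (codeVar i) leaf
  codeC (new n _)      = node 1 (node n leaf leaf) leaf
  codeC (π₁ {S = S} w) = node 2 (codeTy S) (codeC w)
  codeC (π₂ {T = T} w) = node 3 (codeTy T) (codeC w)

  codeC-injective : ∀ {T} (w w′ : CT T) → codeC w ≡ codeC w′ → w ≡ w′
  codeC-injective (base i) (base j) e = cong base (codeVar-injective i j (node-inj₁ e))
  codeC-injective (new n refl) (new m q) e with node-inj₀ (node-inj₁ e)
  codeC-injective (new n refl) (new m refl) e | refl = refl
  codeC-injective (π₁ {S = S} w) (π₁ {S = S′} w′) e with codeTy-injective S S′ (node-inj₁ e)
  ... | refl = cong π₁ (codeC-injective w w′ (node-inj₂ e))
  codeC-injective (π₂ {T = T} w) (π₂ {T = T′} w′) e with codeTy-injective T T′ (node-inj₁ e)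
  ... | refl = cong π₂ (codeC-injective w w′ (node-inj₂ e))

  module SideSyntax (Δ : Ctx) (r : ∀ {T} → Γ ∋ T → Δ ∋ T) (Fs : List (Σ Ctx Fm)) where

    -- The flag of `new` is `true` for common constants and `false` for those of one side. Constants
    -- exist at all types and indices, so a term carries no proof that its constants have been
    -- introduced; `bound` tells when it may be used.
    data Trm : Ty → Set where
      base : ∀ {T} → Δ ∋ T → Trm T
      new  : ∀ {T} → Bool → ℕ → Trm T
      ⟨⟩   : Trm unit
      pair : ∀ {T S} → Trm T → Trm S → Trm (T ⊗ S)
      π₁   : ∀ {T S} → Trm (T ⊗ S) → Trm T
      π₂   : ∀ {T S} → Trm (T ⊗ S) → Trm S

    embed : ∀ {T} → CT T → Trm T
    embed (base i)  = base (r i)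
    embed (new n _) = new true n
    embed (π₁ w)    = π₁ (embed w)
    embed (π₂ w)    = π₂ (embed w)

    Sub : Ctx → Set
    Sub []      = ⊤
    Sub (T ∷ Γ′) = Trm T × Sub Γ′

    get-sub : ∀ {Γ′ T} → Sub Γ′ → Γ′ ∋ T → Trm T
    get-sub (t , σ) here      = t
    get-sub (t , σ) (there i) = get-sub σ i

    tabulate : ∀ {Γ′} → (∀ {T} → Γ′ ∋ T → Trm T) → Sub Γ′
    tabulate {[]} f     = tt
    tabulate {T ∷ Γ′} f = f here , tabulate (λ i → f (there i))

    get-tabulate : ∀ {Γ′ T} (f : ∀ {T} → Γ′ ∋ T → Trm T) (i : Γ′ ∋ T) → get-sub (tabulate f) i ≡ f i
    get-tabulate f here      = refl
    get-tabulate f (there i) = get-tabulate (λ j → f (there j)) i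

    inst : ∀ {Γ′ T} → Tm Γ′ T → Sub Γ′ → Trm T
    inst (var i) σ    = get-sub σ i
    inst ⟨⟩ σ         = ⟨⟩
    inst (pair t s) σ = pair (inst t σ) (inst s σ)
    inst (π₁ t) σ     = π₁ (inst t σ)
    inst (π₂ t) σ     = π₂ (inst t σ)

    bound : ∀ {T} → Trm T → ℕ
    bound (base i)   = 0
    bound (new b n)  = suc n
    bound ⟨⟩         = 0
    bound (pair t s) = bound t ⊔ bound s
    bound (π₁ t)     = bound t
    bound (π₂ t)     = bound t

    boundS : ∀ {Γ′} → Sub Γ′ → ℕ
    boundS {[]} _            = 0
    boundS {T ∷ Γ′} (t , σ) = bound t ⊔ boundS σ

    code : ∀ {T} → Trm T → Tree
    code (base i)       = node 0 (codeVar i) leaf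
    code (new b n)      = node 1 (codeBool b) (node n leaf leaf)
    code ⟨⟩             = leaf
    code (pair t s)     = node 3 (code t) (code s)
    code (π₁ {S = S} t) = node 4 (codeTy S) (code t)
    code (π₂ {T = T} t) = node 5 (codeTy T) (code t)

    code-injective : ∀ {T} (t t′ : Trm T) → code t ≡ code t′ → t ≡ t′
    code-injective (base i) (base j) e = cong base (codeVar-injective i j (node-inj₁ e))
    code-injective (new b n) (new c m) e =
      cong₂ new (codeBool-injective b c (node-inj₁ e)) (node-inj₀ (node-inj₂ e))
    code-injective ⟨⟩ ⟨⟩ _ = refl
    code-injective (pair t s) (pair t′ s′) e =
      cong₂ pair (code-injective t t′ (node-inj₁ e)) (code-injective s s′ (node-inj₂ e))
    code-injective (π₁ {S = S} t) (π₁ {S = S′} t′) e with codeTy-injective S S′ (node-inj₁ e)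
    ... | refl = cong π₁ (code-injective t t′ (node-inj₂ e))
    code-injective (π₂ {T = T} t) (π₂ {T = T′} t′) e with codeTy-injective T T′ (node-inj₁ e)
    ... | refl = cong π₂ (code-injective t t′ (node-inj₂ e))

    codeS : ∀ {Γ′} → Sub Γ′ → Tree
    codeS {[]} _            = leaf
    codeS {T ∷ Γ′} (t , σ) = node 0 (code t) (codeS σ)

    codeS-injective : ∀ {Γ′} (σ σ′ : Sub Γ′) → codeS σ ≡ codeS σ′ → σ ≡ σ′
    codeS-injective {[]} _ _ _ = refl
    codeS-injective {T ∷ Γ′} (t , σ) (t′ , σ′) e =
      cong₂ _,_ (code-injective t t′ (node-inj₁ e)) (codeS-injective σ σ′ (node-inj₂ e))

    -- The predicates that the construction decides, adding a witness if they are inhabited.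
    data Query : Set where
      diffQ : ∀ T → Trm (set T) → Trm (set T) → Query
      eqQ   : Trm ur → Trm ur → Query
      fmQ   : ∀ {Γ′ A} → (Γ′ , A) ∈ₗ Fs → Sub Γ′ → Query

    boundQ : Query → ℕ
    boundQ (diffQ T t s) = bound t ⊔ bound s
    boundQ (eqQ t s)     = bound t ⊔ bound s
    boundQ (fmQ p σ)     = boundS σ

    codeQ : Query → Tree
    codeQ (diffQ T t s) = node 0 (codeTy T) (node 0 (code t) (code s))
    codeQ (eqQ t s)     = node 1 (code t) (code s)
    codeQ (fmQ p σ)     = node (2 + toℕ (index p)) (codeS σ) leaf

    codeQ-injective : ∀ q q′ → codeQ q ≡ codeQ q′ → q ≡ q′
    codeQ-injective (diffQ T t s) (diffQ T′ t′ s′) e with codeTy-injective T T′ (node-inj₁ e)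
    ... | refl = cong₂ (diffQ T) (code-injective t t′ (node-inj₁ (node-inj₂ e)))
                                 (code-injective s s′ (node-inj₂ (node-inj₂ e)))
    codeQ-injective (eqQ t s) (eqQ t′ s′) e =
      cong₂ eqQ (code-injective t t′ (node-inj₁ e)) (code-injective s s′ (node-inj₂ e))
    codeQ-injective (fmQ p σ) (fmQ p′ σ′) e
      with index-injective p p′ (suc-injective (suc-injective (node-inj₀ e)))
    ... | refl = cong (fmQ p) (codeS-injective σ σ′ (node-inj₁ e))

-- Valuations and the collapse of a theory

module Valuations (em₀ : ExcludedMiddle 0ℓ) (em₁ : ExcludedMiddle (lsuc 0ℓ))
                  (U : Set) (ι : ℕ ↣ U) (dflt : (T : Ty) → Sem.⟦_⟧ U T) where
  open Semantics em₀ em₁ U dflt public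

  Assignment : Set₁
  Assignment = Bool → ∀ T → ℕ → ⟦ T ⟧

  update : Assignment → ∀ b T → ℕ → ⟦ T ⟧ → Assignment
  update f b T k x b′ T′ n with em₀ {_≡_ {A = Bool × Ty × ℕ} (b , T , k) (b′ , T′ , n)}
  ... | yes refl = x
  ... | no _     = f b′ T′ n

  update-same : ∀ f b T k x → update f b T k x b T k ≡ x
  update-same f b T k x with em₀ {_≡_ {A = Bool × Ty × ℕ} (b , T , k) (b , T , k)}
  ... | yes refl = refl
  ... | no n     = ⊥-elim (n refl)

  update-other : ∀ f b T k x b′ T′ n → _≢_ {A = Bool × Ty × ℕ} (b , T , k) (b′ , T′ , n) →
    update f b T k x b′ T′ n ≡ f b′ T′ n
  update-other f b T k x b′ T′ n ne with em₀ {_≡_ {A = Bool × Ty × ℕ} (b , T , k) (b′ , T′ , n)}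
  ... | yes e = ⊥-elim (ne e)
  ... | no _  = refl

  restrict : ∀ {Γ Δ} → (∀ {T} → Γ ∋ T → Δ ∋ T) → Env Δ → Env Γ
  restrict {[]} r ρ    = lift tt
  restrict {T ∷ Γ} r ρ = lookup ρ (r here) , restrict (λ i → r (there i)) ρ

  lookup-restrict : ∀ {Γ Δ} (r : ∀ {T} → Γ ∋ T → Δ ∋ T) ρ {T} (i : Γ ∋ T) →
    lookup (restrict r ρ) i ≡ lookup ρ (r i)
  lookup-restrict r ρ here      = refl
  lookup-restrict r ρ (there i) = lookup-restrict (λ j → r (there j)) ρ i

  Restricts : ∀ {Γ Δ} → (∀ {T} → Γ ∋ T → Δ ∋ T) → Env Δ → Env Γ → Set₁
  Restricts {Γ} r ρ γ = ∀ {T} (i : Γ ∋ T) → lookup γ i ≡ lookup ρ (r i)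

  restrict-unique : ∀ {Γ Δ} (r : ∀ {T} → Γ ∋ T → Δ ∋ T) ρ γ → Restricts r ρ γ → γ ≡ restrict r ρ
  restrict-unique {[]} r ρ γ h          = refl
  restrict-unique {T ∷ Γ} r ρ (x , γ) h = cong₂ _,_ (h here) (restrict-unique (λ i → r (there i)) ρ γ (λ i → h (there i)))

  record Val (Δ : Ctx) : Set₁ where
    constructor val⟨_,_⟩
    field
      env : Env Δ
      at  : Assignment
  open Val public

  Agree : ∀ {Δ} → ℕ → Val Δ → Val Δ → Set₁
  Agree k V W = env V ≡ env W × (∀ b T n → n < k → at V b T n ≡ at W b T n)

  Agree-mono : ∀ {Δ k l} {V W : Val Δ} → k ≤ l → Agree l V W → Agree k V W
  Agree-mono k≤l (e , h) = e , λ b T n p → h b T n (≤-trans p k≤l)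

  -- A theory of stage k constrains only indices below k. Values at index k can therefore be chosen
  -- freely, which makes the new constants fresh.
  Supp : ∀ {Δ} → ℕ → (Val Δ → Set₁) → Set₁
  Supp k Θ = ∀ V W → Agree k V W → Θ V → Θ W

  Supp-mono : ∀ {Δ k l} {Θ : Val Δ → Set₁} → k ≤ l → Supp k Θ → Supp l Θ
  Supp-mono k≤l s V W a = s V W (Agree-mono {V = V} {W} k≤l a)

  Supp-∧ : ∀ {Δ k} {Θ Φ : Val Δ → Set₁} → Supp k Θ → Supp k Φ → Supp k (λ V → Θ V × Φ V)
  Supp-∧ s t V W a (p , q) = s V W a p , t V W a q

  module _ (τ : ℕ → Ty) where

    -- Stage k introduces a common variable of type τ k and, on each side, own
    -- variables of all types, all with index k.
    upd : ∀ {Δ} k → ⟦ τ k ⟧ → ∀ T → ⟦ T ⟧ → Val Δ → Val Δ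
    upd k x T y V = val⟨ env V , update (update (at V) false T k y) true (τ k) k x ⟩

    upd-common : ∀ {Δ} k x T y (V : Val Δ) → at (upd k x T y V) true (τ k) k ≡ x
    upd-common k x T y V = update-same (update (at V) false T k y) true (τ k) k x

    upd-own : ∀ {Δ} k x T y (V : Val Δ) → at (upd k x T y V) false T k ≡ y
    upd-own k x T y V =
      trans (update-other (update (at V) false T k y) true (τ k) k x false T k λ ())
            (update-same (at V) false T k y)

    upd-agree : ∀ {Δ} k x T y (V : Val Δ) → Agree k V (upd k x T y V)
    upd-agree k x T y V = refl , λ b S n p →
      sym (trans (update-other (update (at V) false T k y) true (τ k) k x b S n λ { refl → <-irrefl refl p })
                 (update-other (at V) false T k y b S n λ { refl → <-irrefl refl p }))

  module Side (τ : ℕ → Ty) (Γ Δ : Ctx) (r : ∀ {T} → Γ ∋ T → Δ ∋ T) (Fs : List (Σ Ctx Fm)) where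
    open Common τ Γ
    open SideSyntax Δ r Fs

    evT : ∀ {T} → Trm T → Val Δ → ⟦ T ⟧
    evT (base i) V        = lookup (env V) i
    evT (new {T} b n) V   = at V b T n
    evT ⟨⟩ V              = lift tt
    evT (pair t s) V      = evT t V , evT s V
    evT (π₁ t) V          = proj₁ (evT t V)
    evT (π₂ t) V          = proj₂ (evT t V)

    evS : ∀ {Γ′} → Sub Γ′ → Val Δ → Env Γ′
    evS {[]} σ V             = lift tt
    evS {T ∷ Γ′} (t , σ) V = evT t V , evS σ V

    lookup-evS : ∀ {Γ′ T} (σ : Sub Γ′) (i : Γ′ ∋ T) V → lookup (evS σ V) i ≡ evT (get-sub σ i) V
    lookup-evS (t , σ) here V      = refl
    lookup-evS (t , σ) (there i) V = lookup-evS σ i V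

    evT-inst : ∀ {Γ′ T} (t : Tm Γ′ T) (σ : Sub Γ′) V → evalTm t (evS σ V) ≡ evT (inst t σ) V
    evT-inst (var i) σ V    = lookup-evS σ i V
    evT-inst ⟨⟩ σ V         = refl
    evT-inst (pair t s) σ V = cong₂ _,_ (evT-inst t σ V) (evT-inst s σ V)
    evT-inst (π₁ t) σ V     = cong proj₁ (evT-inst t σ V)
    evT-inst (π₂ t) σ V     = cong proj₂ (evT-inst t σ V)

    evS-tabulate : ∀ {Γ′} (f : ∀ {T} → Γ′ ∋ T → Trm T) V (ρ : Env Γ′) →
      (∀ {T} (i : Γ′ ∋ T) → evT (f i) V ≡ lookup ρ i) → evS (tabulate f) V ≡ ρ
    evS-tabulate {[]} f V ρ h           = refl
    evS-tabulate {T ∷ Γ′} f V (x , ρ) h = cong₂ _,_ (h here) (evS-tabulate (λ i → f (there i)) V ρ (λ i → h (there i)))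

    evT-agree : ∀ {T k} (t : Trm T) → bound t ≤ k → ∀ {V W} → Agree k V W → evT t V ≡ evT t W
    evT-agree (base i) p a   = cong (λ ρ → lookup ρ i) (proj₁ a)
    evT-agree (new {T} b n) p a = proj₂ a b T n p
    evT-agree ⟨⟩ p a         = refl
    evT-agree (pair t s) p a = cong₂ _,_ (evT-agree t (m⊔n≤o⇒m≤o (bound t) (bound s) p) a)
                                         (evT-agree s (m⊔n≤o⇒n≤o (bound t) (bound s) p) a)
    evT-agree (π₁ t) p a     = cong proj₁ (evT-agree t p a)
    evT-agree (π₂ t) p a     = cong proj₂ (evT-agree t p a)

    evS-agree : ∀ {Γ′ k} (σ : Sub Γ′) → boundS σ ≤ k → ∀ {V W} → Agree k V W → evS σ V ≡ evS σ W
    evS-agree {[]} σ p a            = refl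
    evS-agree {T ∷ Γ′} (t , σ) p a = cong₂ _,_ (evT-agree t (m⊔n≤o⇒m≤o (bound t) (boundS σ) p) a)
                                                (evS-agree σ (m⊔n≤o⇒n≤o (bound t) (boundS σ) p) a)

    commonEnv : ∀ k → Val Δ → Env (ctx k)
    commonEnv zero V    = restrict r (env V)
    commonEnv (suc k) V = at V true (τ k) k , commonEnv k V

    commonEnv-agree : ∀ k {V W} → Agree k V W → commonEnv k V ≡ commonEnv k W
    commonEnv-agree zero (e , _) = cong (restrict r) e
    commonEnv-agree (suc k) {V} {W} a = cong₂ _,_ (proj₂ a true (τ k) k ≤-refl)
      (commonEnv-agree k (Agree-mono {V = V} {W} (n≤1+n k) a))

    commonEnv-upd : ∀ k x T y V → commonEnv (suc k) (upd τ k x T y V) ≡ (x , commonEnv k V)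
    commonEnv-upd k x T y V = cong₂ _,_ (upd-common τ k x T y V)
      (sym (commonEnv-agree k (upd-agree τ k x T y V)))

    lookup-position : ∀ {n k} (p : suc n ≤′ k) V → lookup (commonEnv k V) (position p) ≡ at V true (τ n) n
    lookup-position ≤′-refl V     = refl
    lookup-position (≤′-step p) V = lookup-position p V

    lookup-weaken : ∀ {T} k (i : Γ ∋ T) V → lookup (commonEnv k V) (weaken k i) ≡ lookup (env V) (r i)
    lookup-weaken zero i V    = lookup-restrict r (env V) i
    lookup-weaken (suc k) i V = lookup-weaken k i V

    ev-toNRC : ∀ {T} (w : CT T) {k} (p : boundC w ≤ k) V → ev (toNRC w p) (commonEnv k V) ≡ evT (embed w) V
    ev-toNRC (base i) {k} p V   = lookup-weaken k i V
    ev-toNRC (new n refl) p V   = lookup-position (≤⇒≤′ p) V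
    ev-toNRC (π₁ w) p V         = cong proj₁ (ev-toNRC w p V)
    ev-toNRC (π₂ w) p V         = cong proj₂ (ev-toNRC w p V)

    bound-embed : ∀ {T} (w : CT T) → bound (embed w) ≡ boundC w
    bound-embed (base i)  = refl
    bound-embed (new n _) = refl
    bound-embed (π₁ w)    = bound-embed w
    bound-embed (π₂ w)    = bound-embed w

    witnessTy : ∀ {Γ′} → Fm Γ′ → Ty
    witnessTy (ex {T = T} t A) = T
    witnessTy _                = unit

    -- Entailment by a stage is not prime, so `ex` and `or` need decisions. For `or` a dummy witness
    -- records that the left disjunct holds; a negative answer forces the right one.
    Witness : ∀ {Γ′} (A : Fm Γ′) → ⟦ witnessTy A ⟧ → Env Γ′ → Set₁
    Witness (ex t A) x ρ   = Lift (lsuc 0ℓ) (x ∈ evalTm t ρ) × SatF A (x , ρ)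
    Witness (or A B) x ρ   = SatF A ρ
    Witness (eq _ _) x ρ   = Lift _ ⊤
    Witness (neq _ _) x ρ  = Lift _ ⊤
    Witness (mem _ _) x ρ  = Lift _ ⊤
    Witness (and _ _) x ρ  = Lift _ ⊤
    Witness (all _ _) x ρ  = Lift _ ⊤
    Witness (wk _) x ρ     = Lift _ ⊤

    tyQ : Query → Ty
    tyQ (diffQ T t s)     = T
    tyQ (eqQ t s)         = unit
    tyQ (fmQ {A = A} p σ) = witnessTy A

    Answer : (q : Query) → ⟦ tyQ q ⟧ → Val Δ → Set₁
    Answer (diffQ T t s) x V     = Lift (lsuc 0ℓ) (x ∈ evT t V × ¬ (x ∈ evT s V))
    Answer (eqQ t s) x V         = evT t V ≡ evT s V
    Answer (fmQ {A = A} p σ) x V = Witness A x (evS σ V)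

    Answer-agree : ∀ {k} q → boundQ q ≤ k → ∀ x {V W} → Agree k V W → Answer q x V → Answer q x W
    Answer-agree (diffQ T t s) p x a (lift (m , n)) = lift
      ( subst (x ∈_) (evT-agree t (m⊔n≤o⇒m≤o (bound t) (bound s) p) a) m
      , λ m′ → n (subst (x ∈_) (sym (evT-agree s (m⊔n≤o⇒n≤o (bound t) (bound s) p) a)) m′))
    Answer-agree (eqQ t s) p x a h =
      subst₂ _≡_ (evT-agree t (m⊔n≤o⇒m≤o (bound t) (bound s) p) a) (evT-agree s (m⊔n≤o⇒n≤o (bound t) (bound s) p) a) h
    Answer-agree (fmQ {A = A} _ σ) p x a h = subst (Witness A x) (evS-agree σ p a) h

    -- The stages `Θ` shrink and each is consistent, though their intersection may be empty.
    -- Entailment `⊩` is therefore entailment by some stage. The `tag` keeps the private atoms of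
    -- the two sides apart.
    module Model (tag : ℕ) (Θ : ℕ → Val Δ → Set₁) (Θ-step : ∀ k V → Θ (suc k) V → Θ k V)
                 (consistent : ∀ k → ¬ (∀ V → ¬ Θ k V)) where

      infix 2 ⊩_
      ⊩_ : (Val Δ → Set₁) → Set₁
      ⊩ P = Σ ℕ λ k → ∀ V → Θ k V → P V

      Θ-mono : ∀ {k l} → k ≤′ l → ∀ V → Θ l V → Θ k V
      Θ-mono ≤′-refl V h     = h
      Θ-mono (≤′-step p) V h = Θ-mono p V (Θ-step _ V h)

      ⊩-mono : ∀ {P Q : Val Δ → Set₁} → ⊩ P → (∀ V → P V → Q V) → ⊩ Q
      ⊩-mono (k , h) f = k , λ V θ → f V (h V θ)

      ⊩-∧ : ∀ {P Q : Val Δ → Set₁} → ⊩ P → ⊩ Q → ⊩ (λ V → P V × Q V)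
      ⊩-∧ (k , h) (l , g) = k ⊔ l , λ V θ →
        h V (Θ-mono (≤⇒≤′ (m≤m⊔n k l)) V θ) , g V (Θ-mono (≤⇒≤′ (m≤n⊔m k l)) V θ)

      ⊩-mono₂ : ∀ {P Q R : Val Δ → Set₁} → ⊩ P → ⊩ Q → (∀ V → P V → Q V → R V) → ⊩ R
      ⊩-mono₂ p q f = ⊩-mono (⊩-∧ p q) λ V (a , b) → f V a b

      ⊩-consistent : ∀ {P : Val Δ → Set₁} → ⊩ P → ¬ (∀ V → ¬ P V)
      ⊩-consistent (k , h) n = consistent k λ V θ → n V (h V θ)

      _≐_ : ∀ {T} → Trm T → Trm T → Val Δ → Set₁
      _≐_ {T} t s V = Eq T (evT t V) (evT s V)

      _∈̇_ : ∀ {T} → Trm T → Trm (set T) → Val Δ → Set₁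
      (t ∈̇ s) V = Lift _ (evT t V ∈ evT s V)

      CommonCode : Trm ur → ℕ → Set₁
      CommonCode t n = Σ (CT ur) λ w → ⌜ codeC w ⌝ ≡ n × (⊩ t ≐ embed w)

      OwnCode : Trm ur → ℕ → Set₁
      OwnCode t n = Σ (Trm ur) λ s → ⌜ code s ⌝ ≡ n × (⊩ t ≐ s)

      -- The atom named by t is determined by the least code of a term equal to t,
      -- where common terms take precedence.
      atomCode : (t : Trm ur) → Σ ℕ λ n →
        (Σ ℕ λ m → n ≡ pr 0 m × Least (CommonCode t) m) ⊎
        (¬ ∃ (CommonCode t)) × (Σ ℕ λ m → n ≡ pr (suc tag) m × Least (OwnCode t) m)
      atomCode t with em₁ {∃ (CommonCode t)}
      ... | yes (_ , c) with least (CommonCode t) c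
      ...   | m , l = pr 0 m , inj₁ (m , refl , l)
      atomCode t | no n with least (OwnCode t) (t , refl , 0 , λ _ _ → Eq-refl ur)
      ...   | m , l = pr (suc tag) m , inj₂ (n , m , refl , l)

      atom : Trm ur → U
      atom t = Injection.to ι (proj₁ (atomCode t))

      ≐-sym : ∀ {T} (t s : Trm T) → ⊩ t ≐ s → ⊩ s ≐ t
      ≐-sym {T} t s h = ⊩-mono h λ V e → Eq-sym T e

      ≐-trans : ∀ {T} (t s u : Trm T) → ⊩ t ≐ s → ⊩ s ≐ u → ⊩ t ≐ u
      ≐-trans {T} t s u h g = ⊩-mono₂ h g λ V e f → Eq-trans T e f

      CommonCode-cong : ∀ t s → ⊩ t ≐ s → ∀ n → CommonCode t n → CommonCode s n
      CommonCode-cong t s e n (w , c , h) = w , c , ≐-trans s t (embed w) (≐-sym t s e) h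

      OwnCode-cong : ∀ t s → ⊩ t ≐ s → ∀ n → OwnCode t n → OwnCode s n
      OwnCode-cong t s e n (w , c , h) = w , c , ≐-trans s t w (≐-sym t s e) h

      atom-cong : ∀ t s → ⊩ t ≐ s → atom t ≡ atom s
      atom-cong t s e with atomCode t | atomCode s
      ... | _ , inj₁ (m , refl , l) | _ , inj₁ (m′ , refl , l′) =
        cong (λ m → Injection.to ι (pr 0 m))
          (least-unique (CommonCode-cong t s e) (CommonCode-cong s t (≐-sym t s e)) l l′)
      ... | _ , inj₁ (m , refl , c , _) | _ , inj₂ (n , _) = ⊥-elim (n (m , CommonCode-cong t s e m c))
      ... | _ , inj₂ (n , _) | _ , inj₁ (m , refl , c , _) =
        ⊥-elim (n (m , CommonCode-cong s t (≐-sym t s e) m c))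
      ... | _ , inj₂ (_ , m , refl , l) | _ , inj₂ (_ , m′ , refl , l′) =
        cong (λ m → Injection.to ι (pr (suc tag) m))
          (least-unique (OwnCode-cong t s e) (OwnCode-cong s t (≐-sym t s e)) l l′)

      atom-injective : ∀ t s → atom t ≡ atom s → ⊩ t ≐ s
      atom-injective t s e with atomCode t | atomCode s | Injection.injective ι e
      ... | _ , inj₁ (m , refl , (w , c , h) , _) | _ , inj₁ (m′ , refl , (w′ , c′ , h′) , _) | e′
        with refl ← cong proj₂ (pr-injective {0} {m} {0} {m′} e′)
        with refl ← codeC-injective w w′ (⌜⌝-injective _ _ (trans c (sym c′))) =
        ≐-trans t (embed w) s h (≐-sym s (embed w) h′)
      ... | _ , inj₂ (_ , m , refl , (w , c , h) , _) | _ , inj₂ (_ , m′ , refl , (w′ , c′ , h′) , _) | e′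
        with refl ← cong proj₂ (pr-injective {suc tag} {m} {suc tag} {m′} e′)
        with refl ← code-injective w w′ (⌜⌝-injective _ _ (trans c (sym c′))) =
        ≐-trans t w s h (≐-sym s w h′)
      ... | _ , inj₁ (m , refl , _) | _ , inj₂ (_ , m′ , refl , _) | e′
        with () ← cong proj₁ (pr-injective {0} {m} {suc tag} {m′} e′)
      ... | _ , inj₂ (_ , m , refl , _) | _ , inj₁ (m′ , refl , _) | e′
        with () ← cong proj₁ (pr-injective {suc tag} {m} {0} {m′} e′)

      -- Recursion on the type takes the place of well-foundedness of membership in Mostowski's
      -- collapse.
      collapse : ∀ {T} → Trm T → ⟦ T ⟧
      collapse {ur} t    = lift (atom t)
      collapse {unit} t  = lift tt
      collapse {T ⊗ S} t = collapse (π₁ t) , collapse (π₂ t)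
      collapse {set T} t = (λ x → Small (Σ (Trm T) λ u → (⊩ u ∈̇ t) × Eq T (collapse u) x)) ,
        λ x y e p → let (u , h , f) = fromSmall p in toSmall (u , h , Eq-trans T f e)

      ∈-collapse : ∀ {T} {x : ⟦ T ⟧} {t : Trm (set T)} → x ∈ collapse t →
        Σ (Trm T) λ u → (⊩ u ∈̇ t) × Eq T (collapse u) x
      ∈-collapse = fromSmall

      collapse-∈ : ∀ {T} (u : Trm T) (t : Trm (set T)) → ⊩ u ∈̇ t → collapse u ∈ collapse t
      collapse-∈ {T} u t h = toSmall (u , h , Eq-refl T)

      collapse-cong : ∀ {T} (t s : Trm T) → ⊩ t ≐ s → Eq T (collapse t) (collapse s)
      collapse-cong {ur} t s e    = lift (atom-cong t s e)
      collapse-cong {unit} t s e  = lift tt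
      collapse-cong {T ⊗ S} t s e = collapse-cong (π₁ t) (π₁ s) (⊩-mono e λ _ → proj₁) ,
                                    collapse-cong (π₂ t) (π₂ s) (⊩-mono e λ _ → proj₂)
      collapse-cong {set T} t s e x =
        (λ p → let (u , h , f) = fromSmall p in toSmall (u , ⊩-mono₂ h e (λ V m d → lift (proj₁ (d _) (lower m))) , f)) ,
        (λ p → let (u , h , f) = fromSmall p in toSmall (u , ⊩-mono₂ h e (λ V m d → lift (proj₂ (d _) (lower m))) , f))

      module Truth (answers : ∀ q → (Σ (Trm (tyQ q)) λ u → ⊩ λ V → Answer q (evT u V) V) ⊎
                                    (⊩ λ V → ∀ x → ¬ Answer q x V)) where

        -- Extensionality of the term model, by induction on the type. Unless t ⊆ s is entailed,
        -- `diffQ` supplies a term u entailed to lie in t and not in s. Its collapse lies in that of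
        -- t, hence in that of s, and the induction hypothesis inverts this to an entailed u ∈ s,
        -- against consistency.
        collapse-injective : ∀ {T} (t s : Trm T) → Eq T (collapse t) (collapse s) → ⊩ t ≐ s
        collapse-⊆ : ∀ {T} (t s : Trm (set T)) → (∀ x → x ∈ collapse t → x ∈ collapse s) →
          ⊩ λ V → ∀ x → x ∈ evT t V → x ∈ evT s V
        ∈-collapse-inverse : ∀ {T} (u : Trm T) (t : Trm (set T)) → collapse u ∈ collapse t → ⊩ u ∈̇ t

        collapse-injective {ur} t s e    = atom-injective t s (lower e)
        collapse-injective {unit} t s e  = 0 , λ _ _ → lift tt
        collapse-injective {T ⊗ S} t s (e , f) =
          ⊩-∧ (collapse-injective (π₁ t) (π₁ s) e) (collapse-injective (π₂ t) (π₂ s) f)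
        collapse-injective {set T} t s e =
          ⊩-mono₂ (collapse-⊆ t s (λ x → proj₁ (e x))) (collapse-⊆ s t (λ x → proj₂ (e x))) λ V a b x → a x , b x

        collapse-⊆ {T} t s sub with answers (diffQ T t s)
        ... | inj₂ h = ⊩-mono h λ V n x m → decide V x m (n x)
          where
          decide : ∀ V x → x ∈ evT t V → ¬ Lift _ (x ∈ evT t V × ¬ (x ∈ evT s V)) → x ∈ evT s V
          decide V x m n with em₀ {x ∈ evT s V}
          ... | yes p = p
          ... | no ¬p = ⊥-elim (n (lift (m , ¬p)))
        ... | inj₁ (u , h) = ⊥-elim (⊩-consistent
          (⊩-∧ h (∈-collapse-inverse u s (sub _ (collapse-∈ u t (⊩-mono h λ V (lift (m , _)) → lift m)))))
          λ V (lift (_ , n) , lift m) → n m)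

        ∈-collapse-inverse {T} u t p with fromSmall p
        ... | u′ , h , e = ⊩-mono₂ h (collapse-injective u′ u e) λ V (lift m) e → lift (proj₂ (evT t V) _ _ e m)

        collapseS : ∀ {Γ′} → Sub Γ′ → Env Γ′
        collapseS {[]} σ             = lift tt
        collapseS {T ∷ Γ′} (t , σ) = collapse t , collapseS σ

        lookup-collapseS : ∀ {Γ′ T} (σ : Sub Γ′) (i : Γ′ ∋ T) → lookup (collapseS σ) i ≡ collapse (get-sub σ i)
        lookup-collapseS (t , σ) here      = refl
        lookup-collapseS (t , σ) (there i) = lookup-collapseS σ i

        evalTm-collapse : ∀ {Γ′ T} (t : Tm Γ′ T) (σ : Sub Γ′) → Eq T (evalTm t (collapseS σ)) (collapse (inst t σ))
        evalTm-collapse {T = T} (var i) σ = ≡⇒Eq (lookup-collapseS σ i)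
        evalTm-collapse ⟨⟩ σ      = lift tt
        evalTm-collapse {T = T ⊗ S} (pair t s) σ =
          Eq-trans T (evalTm-collapse t σ) (collapse-cong (inst t σ) (π₁ (inst (pair t s) σ)) (0 , λ _ _ → Eq-refl T)) ,
          Eq-trans S (evalTm-collapse s σ) (collapse-cong (inst s σ) (π₂ (inst (pair t s) σ)) (0 , λ _ _ → Eq-refl S))
        evalTm-collapse (π₁ t) σ  = proj₁ (evalTm-collapse t σ)
        evalTm-collapse (π₂ t) σ  = proj₂ (evalTm-collapse t σ)

        collapse-evalTm : ∀ {Γ′ T} (t : Tm Γ′ T) (σ : Sub Γ′) → Eq T (collapse (inst t σ)) (evalTm t (collapseS σ))
        collapse-evalTm {T = T} t σ = Eq-sym T (evalTm-collapse t σ)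

        Covered : ∀ {Γ′} → Fm Γ′ → Set
        Covered A = ∀ {p} → p ∈ₗ subformulas A → p ∈ₗ Fs

        -- The truth lemma. One direction suffices because negation occurs only in `neq`, where
        -- `collapse-injective` supplies the converse.
        truth : ∀ {Γ′} (A : Fm Γ′) → Covered A → (σ : Sub Γ′) → ⊩ (λ V → SatF A (evS σ V)) → SatF A (collapseS σ)
        truth (eq {T = T} t s) c σ h = Eq-cong T (collapse-evalTm t σ) (collapse-evalTm s σ)
          (collapse-cong (inst t σ) (inst s σ)
            (⊩-mono h λ V e → subst₂ (Eq T) (evT-inst t σ V) (evT-inst s σ V) e))
        truth (neq {T = T} t s) c σ h e = ⊩-consistent
          (⊩-∧ h (collapse-injective (inst t σ) (inst s σ)
            (Eq-cong T (evalTm-collapse t σ) (evalTm-collapse s σ) e)))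
          λ V (n , e′) → n (subst₂ (Eq T) (sym (evT-inst t σ V)) (sym (evT-inst s σ V)) e′)
        truth (mem {T = T} t s) c σ h = lift (∈-resp {s = collapse (inst s σ)} {evalTm s (collapseS σ)}
          (collapse-evalTm t σ) (collapse-evalTm s σ)
          (collapse-∈ (inst t σ) (inst s σ)
            (⊩-mono h λ V (lift m) → lift (subst₂ _∈_ (evT-inst t σ V) (evT-inst s σ V) m))))
        truth (and A B) c σ h =
          truth A (λ p → c (there (∈-++⁺ˡ p))) σ (⊩-mono h λ _ → proj₁) ,
          truth B (λ p → c (there (∈-++⁺ʳ (subformulas A) p))) σ (⊩-mono h λ _ → proj₂)
        truth (or A B) c σ h with answers (fmQ (c (here refl)) σ)
        ... | inj₁ (_ , g) = inj₁ (truth A (λ p → c (there (∈-++⁺ˡ p))) σ g)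
        ... | inj₂ g = inj₂ (truth B (λ p → c (there (∈-++⁺ʳ (subformulas A) p))) σ
          (⊩-mono₂ h g λ { V (inj₁ a) n → ⊥-elim (n (lift tt) a) ; V (inj₂ b) n → b }))
        truth (all {T = T} t A) c σ h x m
          with u , g , e ← ∈-collapse {t = inst t σ} (proj₁ (evalTm-collapse t σ x) m) =
          SatF-cong A (EqEnv-∷ e (λ i → Eq-refl _)) (truth A (λ p → c (there p)) (u , σ)
            (⊩-mono₂ h g λ V a (lift m) → a (evT u V) (subst (evT u V ∈_) (sym (evT-inst t σ V)) m)))
        truth (ex {T = T} t A) c σ h with answers (fmQ (c (here refl)) σ)
        ... | inj₁ (u , g) = collapse u ,
          proj₁ (collapse-evalTm t σ (collapse u)) (collapse-∈ u (inst t σ)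
            (⊩-mono g λ V (m , _) → lift (subst (evT u V ∈_) (evT-inst t σ V) (lower m)))) ,
          truth A (λ p → c (there p)) (u , σ) (⊩-mono g λ _ → proj₂)
        ... | inj₂ g = ⊥-elim (⊩-consistent (⊩-∧ h g) λ V ((x , m , a) , n) → n x (lift m , a))
        truth (wk A) c (_ , σ) h = truth A (λ p → c (there p)) σ h

-- Inseparable theories

module Amalgamation
    (em₀ : ExcludedMiddle 0ℓ) (em₁ : ExcludedMiddle (lsuc 0ℓ))
    (U : Set) (ι : ℕ ↣ U) (dflt : (T : Ty) → Sem.⟦_⟧ U T)
    (τ : ℕ → Ty) (slot : ℕ → ℕ)
    (fair : ∀ T n K → Σ ℕ λ k → K ≤ k × τ k ≡ T × slot k ≡ n)
    (Γ ΔL ΔR : Ctx) (rL : ∀ {T} → Γ ∋ T → ΔL ∋ T) (rR : ∀ {T} → Γ ∋ T → ΔR ∋ T)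
    (φL : Fm ΔL) (φR : Fm ΔR)
    (T : Ty) (Target : Sem.Env U ΔL → Sem.⟦_⟧ U T → Set₁) where

  open Valuations em₀ em₁ U ι dflt
  open Common τ Γ
  module LS = SideSyntax ΔL rL (subformulas φL)
  module RS = SideSyntax ΔR rR (subformulas φR)
  module L = Side τ Γ ΔL rL (subformulas φL)
  module R = Side τ Γ ΔR rR (subformulas φR)

  -- For collection the target is the value of the variable x, up to `Eq`; the empty target turns a
  -- separation into an ordinary interpolant.
  Covers : ⟦ set T ⟧ → Env ΔL → Set₁
  Covers e ρ = Σ _ λ x → Lift (lsuc 0ℓ) (x ∈ e) × Target ρ x

  record Separation (k : ℕ) (ΘL : Val ΔL → Set₁) (ΘR : Val ΔR → Set₁) : Set₁ where
    field
      θ     : NRC (ctx k) (set unit)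
      E     : NRC (ctx k) (set T)
      left  : ∀ V → ΘL V → Holds θ (L.commonEnv k V) ⊎ Covers (ev E (L.commonEnv k V)) (env V)
      right : ∀ V → ΘR V → ¬ Holds θ (R.commonEnv k V)

  open Separation

  ΘLeft ΘRight : Set₂
  ΘLeft  = Val ΔL → Set₁
  ΘRight = Val ΔR → Set₁

  module _ {k : ℕ} {ΘL : ΘLeft} {ΘR : ΘRight} (s : Separation (suc k) ΘL ΘR) where

    left-upd : ∀ {x S y V} → ΘL (upd τ k x S y V) →
      Holds (θ s) (x , L.commonEnv k V) ⊎ Covers (ev (E s) (x , L.commonEnv k V)) (env V)
    left-upd {x} {S} {y} {V} h =
      subst (λ ρ → Holds (θ s) ρ ⊎ Covers (ev (E s) ρ) (env V)) (L.commonEnv-upd k x S y V) (left s _ h)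

    right-upd : ∀ {x S y V} → ΘR (upd τ k x S y V) → ¬ Holds (θ s) (x , R.commonEnv k V)
    right-upd {x} {S} {y} {V} h =
      subst (λ ρ → ¬ Holds (θ s) ρ) (R.commonEnv-upd k x S y V) (right s _ h)

    covers-⋃ : ∀ {c : NRC (ctx k) (set (τ k))} {ρ : Env (ctx k)} {ρ′ x} → x ∈ ev c ρ →
      Covers (ev (E s) (x , ρ)) ρ′ → Covers (ev (bigU (E s) c) ρ) ρ′
    covers-⋃ {x = x} m (z , lift q , t) = z , lift (toSmall (x , m , q)) , t

  -- With `merge-right`, this lets a state decide a query: were both alternatives separable from the
  -- other side, their disjunction would be too. A disjunction on the left joins the conditions by
  -- union, one on the right by intersection.
  merge-left : ∀ {k} {Θ Θ′ : ΘLeft} {ΘR : ΘRight} →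
    Separation k Θ ΘR → Separation k Θ′ ΘR → Separation k (λ V → Θ V ⊎ Θ′ V) ΘR
  merge-left s s′ = record
    { θ = union (θ s) (θ s′)
    ; E = union (E s) (E s′)
    ; left = λ { V (inj₁ h) → [ (λ p → inj₁ (inj₁ p)) , (λ (x , lift m , t) → inj₂ (x , lift (inj₁ m) , t)) ]′ (left s V h)
               ; V (inj₂ h) → [ (λ p → inj₁ (inj₂ p)) , (λ (x , lift m , t) → inj₂ (x , lift (inj₂ m) , t)) ]′ (left s′ V h) }
    ; right = λ V h → [ right s V h , right s′ V h ]′
    }

  Holds-andB : ∀ {Γ} (θ θ′ : NRC Γ (set unit)) ρ → Holds θ ρ → Holds θ′ ρ → Holds (andB θ θ′) ρ
  Holds-andB θ θ′ ρ p q = p , λ (_ , n) → n q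

  andB-Holds : ∀ {Γ} (θ θ′ : NRC Γ (set unit)) ρ → Holds (andB θ θ′) ρ → Holds θ ρ × Holds θ′ ρ
  andB-Holds θ θ′ ρ (p , n) with em₀ {Holds θ′ ρ}
  ... | yes q = p , q
  ... | no ¬q = ⊥-elim (n (p , ¬q))

  merge-right : ∀ {k} {ΘL : ΘLeft} {Θ Θ′ : ΘRight} →
    Separation k ΘL Θ → Separation k ΘL Θ′ → Separation k ΘL (λ V → Θ V ⊎ Θ′ V)
  merge-right {k} s s′ = record
    { θ = andB (θ s) (θ s′)
    ; E = union (E s) (E s′)
    ; left = λ V h → combine V (left s V h) (left s′ V h)
    ; right = λ { V (inj₁ h) p → right s V h (proj₁ (andB-Holds (θ s) (θ s′) _ p))
                ; V (inj₂ h) p → right s′ V h (proj₂ (andB-Holds (θ s) (θ s′) _ p)) }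
    }
    where
    combine : ∀ V → Holds (θ s) (L.commonEnv k V) ⊎ Covers (ev (E s) (L.commonEnv k V)) (env V) →
      Holds (θ s′) (L.commonEnv k V) ⊎ Covers (ev (E s′) (L.commonEnv k V)) (env V) →
      Holds (andB (θ s) (θ s′)) (L.commonEnv k V) ⊎ Covers (ev (union (E s) (E s′)) (L.commonEnv k V)) (env V)
    combine V (inj₁ p) (inj₁ q) = inj₁ (Holds-andB (θ s) (θ s′) (L.commonEnv k V) p q)
    combine V (inj₂ (x , lift m , t)) _ = inj₂ (x , lift (inj₁ m) , t)
    combine V _ (inj₂ (x , lift m , t)) = inj₂ (x , lift (inj₂ m) , t)

  -- Elimination of the common variable of stage k. The side that chooses its value fixes the
  -- quantifier: here the left finds some x in c while the right tolerates every x in c. In `bind-∀`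
  -- the roles are exchanged.
  bind-∃ : ∀ {k} {ΘL ΘL′ : ΘLeft} {ΘR ΘR′ : ΘRight} (c : NRC (ctx k) (set (τ k))) →
    (∀ V → ΘL V → Σ _ λ x → x ∈ ev c (L.commonEnv k V) × Σ _ λ S → Σ _ λ y → ΘL′ (upd τ k x S y V)) →
    (∀ V → ΘR V → ∀ x → x ∈ ev c (R.commonEnv k V) → Σ _ λ S → Σ _ λ y → ΘR′ (upd τ k x S y V)) →
    Separation (suc k) ΘL′ ΘR′ → Separation k ΘL ΘR
  bind-∃ {k} c hL hR s = record
    { θ = anyB c (θ s)
    ; E = bigU (E s) c
    ; left = λ V h → let (x , m , S , y , g) = hL V h in
        [ (λ p → inj₁ (toSmall (x , m , p))) , (λ p → inj₂ (covers-⋃ s {c = c} m p)) ]′ (left-upd s {x} {S} {y} {V} g)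
    ; right = λ V h p → let (x , m , q) = fromSmall p ; (S , y , g) = hR V h x m in
        right-upd s {x} {S} {y} {V} g q
    }

  -- Each x in c may satisfy the left side through `θ` or through `E`. If one does so through `E`,
  -- the union over c covers the target; otherwise all satisfy `θ`.
  bind-∀ : ∀ {k} {ΘL ΘL′ : ΘLeft} {ΘR ΘR′ : ΘRight} (c : NRC (ctx k) (set (τ k))) →
    (∀ V → ΘL V → ∀ x → x ∈ ev c (L.commonEnv k V) → Σ _ λ S → Σ _ λ y → ΘL′ (upd τ k x S y V)) →
    (∀ V → ΘR V → Σ _ λ x → x ∈ ev c (R.commonEnv k V) × Σ _ λ S → Σ _ λ y → ΘR′ (upd τ k x S y V)) →
    Separation (suc k) ΘL′ ΘR′ → Separation k ΘL ΘR
  bind-∀ {k} {ΘL} c hL hR s = record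
    { θ = allB c (θ s)
    ; E = bigU (E s) c
    ; left = split
    ; right = λ V h (_ , n) → let (x , m , S , y , g) = hR V h in
        n (toSmall (x , m , toSmall (lift tt) , right-upd s {x} {S} {y} {V} g))
    }
    where
    split : ∀ V → ΘL V → Holds (allB c (θ s)) (L.commonEnv k V) ⊎ Covers (ev (bigU (E s) c) (L.commonEnv k V)) (env V)
    split V h with em₁ {Covers (ev (bigU (E s) c) (L.commonEnv k V)) (env V)}
    ... | yes p = inj₂ p
    ... | no ¬p = inj₁ (toSmall (lift tt) , λ q → let (x , m , _ , n) = fromSmall q ; (S , y , g) = hL V h x m in
      [ n , (λ r → ¬p (covers-⋃ s {c = c} m r)) ]′ (left-upd s {x} {S} {y} {V} g))

  -- An unconstrained variable is bound to the singleton of `get ∅`, which is an expression at every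
  -- type.
  drop : ∀ {k} {ΘL ΘL′ : ΘLeft} {ΘR ΘR′ : ΘRight} →
    (∀ V → ΘL V → ∀ x → Σ _ λ S → Σ _ λ y → ΘL′ (upd τ k x S y V)) →
    (∀ V → ΘR V → ∀ x → Σ _ λ S → Σ _ λ y → ΘR′ (upd τ k x S y V)) →
    Separation (suc k) ΘL′ ΘR′ → Separation k ΘL ΘR
  drop {k} hL hR = bind-∃ (sng (get ∅))
    (λ V h → let d = ev (get ∅) (L.commonEnv k V) in d , toSmall (Eq-refl (τ k)) , hL V h d)
    (λ V h x _ → hR V h x)

  -- `soundL` is carried along because `set-rule` appeals to `φL` at arbitrary stages.
  record State (k : ℕ) : Set₂ where
    field
      ΘL     : ΘLeft
      ΘR     : ΘRight
      suppL  : Supp k ΘL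
      suppR  : Supp k ΘR
      soundL : ∀ V → ΘL V → SatF φL (env V)
      insep  : ¬ Separation k ΘL ΘR
  open State

  upd-supp : ∀ {Δ k} {Θ : Val Δ → Set₁} → Supp k Θ → ∀ {V x S y} → Θ V → Θ (upd τ k x S y V)
  upd-supp {k = k} σ {V} {x} {S} {y} h = σ V _ (upd-agree τ k x S y V) h

  keep : ∀ {Δ k} {Θ : Val Δ → Set₁} → Supp k Θ → ∀ V → Θ V → ∀ x → Σ _ λ S → Σ _ λ y → Θ (upd τ k x S y V)
  keep {k = k} σ V h x = unit , lift tt , upd-supp σ {V} {x} {unit} {lift tt} h

  idle : ∀ {k} → State k → State (suc k)
  idle {k} s = record
    { ΘL = ΘL s ; ΘR = ΘR s
    ; suppL = Supp-mono {Θ = ΘL s} (n≤1+n k) (suppL s) ; suppR = Supp-mono {Θ = ΘR s} (n≤1+n k) (suppR s)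
    ; soundL = soundL s
    ; insep = λ sep → insep s (drop (keep (suppL s)) (keep (suppR s)) sep)
    }

  module _ {Δ : Ctx} (k : ℕ) {S : Ty} (P : ⟦ S ⟧ → Val Δ → Set₁) where
    Found Empty : Val Δ → Set₁
    Found V = P (at V false S k) V
    Empty V = ∀ x → ¬ P x V

    module _ (agree : ∀ x {V W} → Agree k V W → P x V → P x W) where

      Agree-sym : ∀ {V W : Val Δ} → Agree k V W → Agree k W V
      Agree-sym (e , h) = sym e , λ b T n p → sym (h b T n p)

      Found-supp : Supp (suc k) Found
      Found-supp V W a h = subst (λ x → P x W) (proj₂ a false S k ≤-refl)
        (agree _ (Agree-mono {V = V} {W} (n≤1+n k) a) h)

      Empty-supp : Supp (suc k) Empty
      Empty-supp V W a n x p = n x (agree x {W} {V} (Agree-sym {V} {W} (Agree-mono {V = V} {W} (n≤1+n k) a)) p)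

      -- `Θ` and `P` ignore index k, so the own constant of that index can be set to a witness
      -- whenever one exists.
      found-or-empty : ∀ {Θ : Val Δ → Set₁} → Supp k Θ → ∀ V → Θ V → ∀ x →
        Σ _ λ S′ → Σ _ λ y → let W = upd τ k x S′ y V in (Θ W × Found W) ⊎ (Θ W × Empty W)
      found-or-empty {Θ} σ V h x with em₁ {Σ _ λ y → P y V}
      ... | yes (y , p) = S , y , inj₁ (upd-supp {Θ = Θ} σ {V} {x} {S} {y} h ,
        subst (λ z → P z W) (sym (upd-own τ k x S y V)) (agree y {V} {W} (upd-agree τ k x S y V) p))
        where W = upd τ k x S y V
      ... | no n = unit , lift tt , inj₂ (upd-supp {Θ = Θ} σ {V} {x} {unit} {lift tt} h ,
        λ y p → n (y , agree y {W} {V} (Agree-sym {V} {W} (upd-agree τ k x unit (lift tt) V)) p))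
        where W = upd τ k x unit (lift tt) V

  module _ {k : ℕ} {x : ⟦ τ k ⟧} where

    new-≡ : ∀ {Δ} (V : Val Δ) → at (upd τ k x unit (lift tt) V) true (τ k) k ≡ x
    new-≡ V = upd-common τ k x unit (lift tt) V

    evT-updL : ∀ {S} (t : LS.Trm S) → LS.bound t ≤ k → ∀ V → L.evT t V ≡ L.evT t (upd τ k x unit (lift tt) V)
    evT-updL t p V = L.evT-agree t p (upd-agree τ k x unit (lift tt) V)

    evT-updR : ∀ {S} (t : RS.Trm S) → RS.bound t ≤ k → ∀ V → R.evT t V ≡ R.evT t (upd τ k x unit (lift tt) V)
    evT-updR t p V = R.evT-agree t p (upd-agree τ k x unit (lift tt) V)

  boundL : ∀ {S k} (w : CT S) → boundC w ≤ k → LS.bound (LS.embed w) ≤ k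
  boundL {k = k} w p = subst (_≤ k) (sym (L.bound-embed w)) p

  boundR : ∀ {S k} (w : CT S) → boundC w ≤ k → RS.bound (RS.embed w) ≤ k
  boundR {k = k} w p = subst (_≤ k) (sym (R.bound-embed w)) p

  NewInL : ∀ (k : ℕ) {S} → CT (set S) → ΘLeft
  NewInL k {S} t V = Lift _ (at V true S k ∈ L.evT (LS.embed t) V)

  NewInR : ∀ (k : ℕ) {S} → CT (set S) → ΘRight
  NewInR k {S} t V = Lift _ (at V true S k ∈ R.evT (RS.embed t) V)

  NewIsL : ∀ (k : ℕ) {S} → LS.Trm S → ΘLeft
  NewIsL k {S} u V = Eq S (at V true S k) (L.evT u V)

  NewIsR : ∀ (k : ℕ) {S} → RS.Trm S → ΘRight
  NewIsR k {S} u V = Eq S (at V true S k) (R.evT u V)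

  -- The amalgamation step. The left may equate the new constant with its element u of the common
  -- set t; the right learns only that the constant lies in t. Quantifying existentially over t
  -- undoes the step. `common-right` is dual and uses a universal quantifier.
  common-left : ∀ {k S} (s : State k) → τ k ≡ S → (u : LS.Trm S) (t : CT (set S)) → LS.bound u ≤ k → boundC t ≤ k →
    (∀ V → ΘL s V → L.evT u V ∈ L.evT (LS.embed t) V) →
    ¬ Separation (suc k) (λ V → ΘL s V × NewIsL k u V) (λ V → ΘR s V × NewInR k t V)
  common-left {k} s refl u t bu bt h sep = insep s (bind-∃ (toNRC t bt)
    (λ V θ → L.evT u V , subst (L.evT u V ∈_) (sym (L.ev-toNRC t bt V)) (h V θ) , unit , lift tt ,
      upd-supp {Θ = ΘL s} (suppL s) {V} {L.evT u V} {unit} {lift tt} θ ,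
      ≡⇒Eq (trans (new-≡ V) (evT-updL u bu V)))
    (λ V θ x m → unit , lift tt , upd-supp {Θ = ΘR s} (suppR s) {V} {x} {unit} {lift tt} θ ,
      lift (subst₂ _∈_ (sym (new-≡ V)) (trans (R.ev-toNRC t bt V) (evT-updR (RS.embed t) (boundR t bt) V)) m))
    sep)

  common-right : ∀ {k S} (s : State k) → τ k ≡ S → (u : RS.Trm S) (t : CT (set S)) → RS.bound u ≤ k → boundC t ≤ k →
    (∀ V → ΘR s V → R.evT u V ∈ R.evT (RS.embed t) V) →
    ¬ Separation (suc k) (λ V → ΘL s V × NewInL k t V) (λ V → ΘR s V × NewIsR k u V)
  common-right {k} s refl u t bu bt h sep = insep s (bind-∀ (toNRC t bt)
    (λ V θ x m → unit , lift tt , upd-supp {Θ = ΘL s} (suppL s) {V} {x} {unit} {lift tt} θ ,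
      lift (subst₂ _∈_ (sym (new-≡ V)) (trans (L.ev-toNRC t bt V) (evT-updL (LS.embed t) (boundL t bt) V)) m))
    (λ V θ → R.evT u V , subst (R.evT u V ∈_) (sym (R.ev-toNRC t bt V)) (h V θ) , unit , lift tt ,
      upd-supp {Θ = ΘR s} (suppR s) {V} {R.evT u V} {unit} {lift tt} θ ,
      ≡⇒Eq (trans (new-≡ V) (evT-updR u bu V)))
    sep)

  NewInL-supp : ∀ {k S} (t : CT (set S)) → boundC t ≤ k → Supp (suc k) (NewInL k t)
  NewInL-supp {k} {S} t p V W a (lift m) = lift (subst₂ _∈_ (proj₂ a true S k ≤-refl)
    (L.evT-agree (LS.embed t) (m≤n⇒m≤1+n (boundL t p)) a) m)

  NewInR-supp : ∀ {k S} (t : CT (set S)) → boundC t ≤ k → Supp (suc k) (NewInR k t)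
  NewInR-supp {k} {S} t p V W a (lift m) = lift (subst₂ _∈_ (proj₂ a true S k ≤-refl)
    (R.evT-agree (RS.embed t) (m≤n⇒m≤1+n (boundR t p)) a) m)

  NewIsL-supp : ∀ {k S} (u : LS.Trm S) → LS.bound u ≤ k → Supp (suc k) (NewIsL k u)
  NewIsL-supp {k} {S} u p V W a e = subst₂ (Eq S) (proj₂ a true S k ≤-refl) (L.evT-agree u (m≤n⇒m≤1+n p) a) e

  NewIsR-supp : ∀ {k S} (u : RS.Trm S) → RS.bound u ≤ k → Supp (suc k) (NewIsR k u)
  NewIsR-supp {k} {S} u p V W a e = subst₂ (Eq S) (proj₂ a true S k ≤-refl) (R.evT-agree u (m≤n⇒m≤1+n p) a) e

  extend : ∀ {k} (s : State k) {ΦL : ΘLeft} {ΦR : ΘRight} → Supp (suc k) ΦL → Supp (suc k) ΦR →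
    ¬ Separation (suc k) (λ V → ΘL s V × ΦL V) (λ V → ΘR s V × ΦR V) → State (suc k)
  extend {k} s {ΦL} {ΦR} σL σR n = record
    { ΘL = λ V → ΘL s V × ΦL V ; ΘR = λ V → ΘR s V × ΦR V
    ; suppL = Supp-∧ {Θ = ΘL s} {ΦL} (Supp-mono {Θ = ΘL s} (n≤1+n k) (suppL s)) σL
    ; suppR = Supp-∧ {Θ = ΘR s} {ΦR} (Supp-mono {Θ = ΘR s} (n≤1+n k) (suppR s)) σR
    ; soundL = λ V (h , _) → soundL s V h
    ; insep = n
    }

  extendL : ∀ {k} (s : State k) {ΦL : ΘLeft} → Supp (suc k) ΦL →
    ¬ Separation (suc k) (λ V → ΘL s V × ΦL V) (ΘR s) → State (suc k)
  extendL {k} s {ΦL} σL n = record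
    { ΘL = λ V → ΘL s V × ΦL V ; ΘR = ΘR s
    ; suppL = Supp-∧ {Θ = ΘL s} {ΦL} (Supp-mono {Θ = ΘL s} (n≤1+n k) (suppL s)) σL
    ; suppR = Supp-mono {Θ = ΘR s} (n≤1+n k) (suppR s)
    ; soundL = λ V (h , _) → soundL s V h
    ; insep = n
    }

  extendR : ∀ {k} (s : State k) {ΦR : ΘRight} → Supp (suc k) ΦR →
    ¬ Separation (suc k) (ΘL s) (λ V → ΘR s V × ΦR V) → State (suc k)
  extendR {k} s {ΦR} σR n = record
    { ΘL = ΘL s ; ΘR = λ V → ΘR s V × ΦR V
    ; suppL = Supp-mono {Θ = ΘL s} (n≤1+n k) (suppL s)
    ; suppR = Supp-∧ {Θ = ΘR s} {ΦR} (Supp-mono {Θ = ΘR s} (n≤1+n k) (suppR s)) σR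
    ; soundL = soundL s
    ; insep = n
    }

  -- A goal imposes, on a new common variable, one of two pairs of constraints relative
  -- to a term y of the right side; the rule says that one of them is always consistent.
  record Goal : Set₂ where
    field
      S Y    : Ty
      onL    : Bool → ⟦ S ⟧ → Env ΔL → Set₁
      onR    : Bool → ⟦ S ⟧ → ⟦ Y ⟧ → Set₁
    GoalL : ℕ → Bool → ΘLeft
    GoalL k b V = onL b (at V true S k) (env V)
    GoalR : ℕ → Bool → RS.Trm Y → ΘRight
    GoalR k b y V = onR b (at V true S k) (R.evT y V)
    field
      rule : ∀ {k} (s : State k) → τ k ≡ S → (y : RS.Trm Y) → RS.bound y ≤ k →
        (∀ b → Separation (suc k) (λ V → ΘL s V × GoalL k b V) (λ V → ΘR s V × GoalR k b y V)) → ⊥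

  noGoal : Goal
  noGoal = record
    { S = unit ; Y = unit ; onL = λ _ _ _ → Lift _ ⊤ ; onR = λ _ _ _ → Lift _ ⊤
    ; rule = λ s _ y _ sep → insep s (drop
        (λ V h x → unit , lift tt , upd-supp {Θ = ΘL s} (suppL s) {V} {x} {unit} {lift tt} h , lift tt)
        (λ V h x → unit , lift tt , upd-supp {Θ = ΘR s} (suppR s) {V} {x} {unit} {lift tt} h , lift tt)
        (sep true))
    }

  -- The limit of the construction and the two collapsed models

  module Limit (goal : Goal) (initial : ¬ Separation 0 (λ V → SatF φL (env V)) (λ V → SatF φR (env V))) where
    open Goal goal

    data Task : Set where
      ownL  : LS.Query → Task
      ownR  : RS.Query → Task
      comL  : ∀ T → LS.Trm T → CT (set T) → Task
      comR  : ∀ T → RS.Trm T → CT (set T) → Task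
      aim   : RS.Trm Y → Task

    -- This is the type of the common constant at the stage of the task. A query leaves that
    -- constant unconstrained; its witness is an own constant, which may have any type.
    taskTy : Task → Ty
    taskTy (ownL q)     = unit
    taskTy (ownR q)     = unit
    taskTy (comL T u t) = T
    taskTy (comR T u t) = T
    taskTy (aim y)      = S

    taskBound : Task → ℕ
    taskBound (ownL q)     = LS.boundQ q
    taskBound (ownR q)     = RS.boundQ q
    taskBound (comL T u t) = LS.bound u ⊔ boundC t
    taskBound (comR T u t) = RS.bound u ⊔ boundC t
    taskBound (aim y)      = RS.bound y

    codeTask : Task → Tree
    codeTask (ownL q)     = node 0 (LS.codeQ q) leaf
    codeTask (ownR q)     = node 1 (RS.codeQ q) leaf
    codeTask (comL T u t) = node 2 (codeTy T) (node 0 (LS.code u) (codeC t))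
    codeTask (comR T u t) = node 3 (codeTy T) (node 0 (RS.code u) (codeC t))
    codeTask (aim y)      = node 4 (RS.code y) leaf

    codeTask-injective : ∀ p q → codeTask p ≡ codeTask q → p ≡ q
    codeTask-injective (ownL q) (ownL q′) e = cong ownL (LS.codeQ-injective q q′ (node-inj₁ e))
    codeTask-injective (ownR q) (ownR q′) e = cong ownR (RS.codeQ-injective q q′ (node-inj₁ e))
    codeTask-injective (comL T u t) (comL T′ u′ t′) e with codeTy-injective T T′ (node-inj₁ e)
    ... | refl = cong₂ (comL T) (LS.code-injective u u′ (node-inj₁ (node-inj₂ e)))
                                (codeC-injective t t′ (node-inj₂ (node-inj₂ e)))
    codeTask-injective (comR T u t) (comR T′ u′ t′) e with codeTy-injective T T′ (node-inj₁ e)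
    ... | refl = cong₂ (comR T) (RS.code-injective u u′ (node-inj₁ (node-inj₂ e)))
                                (codeC-injective t t′ (node-inj₂ (node-inj₂ e)))
    codeTask-injective (aim y) (aim y′) e = cong aim (RS.code-injective y y′ (node-inj₁ e))

    task : ℕ → Maybe Task
    task k = decode (λ p → ⌜ codeTask p ⌝) (slot k)

    scheduled : ∀ p K → Σ ℕ λ k → K ≤ k × τ k ≡ taskTy p × task k ≡ just p
    scheduled p K with fair (taskTy p) ⌜ codeTask p ⌝ K
    ... | k , K≤k , e , f = k , K≤k , e , trans (cong (decode _) f)
      (decode-code _ (λ a b h → codeTask-injective a b (⌜⌝-injective _ _ h)) p)

    Ready : ∀ {k} → State k → Task → Set₁
    Ready s (ownL q)     = Lift _ ⊤
    Ready s (ownR q)     = Lift _ ⊤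
    Ready s (comL T u t) = ∀ V → ΘL s V → L.evT u V ∈ L.evT (LS.embed t) V
    Ready s (comR T u t) = ∀ V → ΘR s V → R.evT u V ∈ R.evT (RS.embed t) V
    Ready s (aim y)      = Lift _ ⊤

    Entails : ∀ {Δ} → (Val Δ → Set₁) → (Val Δ → Set₁) → Set₁
    Entails Θ P = ∀ V → Θ V → P V

    Done : ∀ {k} → State (suc k) → Task → Set₁
    Done {k} s (ownL q)     = Entails (ΘL s) (Found k (L.Answer q)) ⊎ Entails (ΘL s) (Empty k (L.Answer q))
    Done {k} s (ownR q)     = Entails (ΘR s) (Found k (R.Answer q)) ⊎ Entails (ΘR s) (Empty k (R.Answer q))
    Done {k} s (comL T u t) = Entails (ΘL s) (NewIsL k u) × Entails (ΘR s) (NewInR k t)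
    Done {k} s (comR T u t) = Entails (ΘR s) (NewIsR k u) × Entails (ΘL s) (NewInL k t)
    Done {k} s (aim y)      = Σ Bool λ b → Entails (ΘL s) (GoalL k b) × Entails (ΘR s) (GoalR k b y)

    record Extension {k} (s : State k) (Finished : State (suc k) → Set₁) : Set₂ where
      field
        state : State (suc k)
        monoL : ∀ V → ΘL state V → ΘL s V
        monoR : ∀ V → ΘR state V → ΘR s V
        finished : Finished state
    open Extension

    GoalL-supp : ∀ k b → Supp (suc k) (GoalL k b)
    GoalL-supp k b V W a h = subst₂ (onL b) (proj₂ a true S k ≤-refl) (proj₁ a) h

    GoalR-supp : ∀ k b y → RS.bound y ≤ k → Supp (suc k) (GoalR k b y)
    GoalR-supp k b y p V W a h =
      subst₂ (onR b) (proj₂ a true S k ≤-refl) (R.evT-agree y (m≤n⇒m≤1+n p) a) h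

    -- Queries and goals try their first alternative. If it is separable then the second is not,
    -- since the two separations would combine into one of `s`, through merging or through the
    -- `rule` of the goal.
    perform : ∀ {k} (s : State k) p → τ k ≡ taskTy p → taskBound p ≤ k → Ready s p →
      Extension s (λ s′ → Done s′ p)
    perform {k} s (ownL q) e b _ with em₁ {Separation (suc k) (λ V → ΘL s V × Found k (L.Answer q) V) (ΘR s)}
    ... | no n = record
      { state = extendL s (Found-supp k (L.Answer q) (L.Answer-agree q b)) n
      ; monoL = λ _ → proj₁ ; monoR = λ _ h → h ; finished = inj₁ λ _ → proj₂ }
    ... | yes sep = record
      { state = extendL s (Empty-supp k (L.Answer q) (L.Answer-agree q b)) λ sep′ → insep s
          (drop (found-or-empty k (L.Answer q) (L.Answer-agree q b) (suppL s)) (keep (suppR s)) (merge-left sep sep′))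
      ; monoL = λ _ → proj₁ ; monoR = λ _ h → h ; finished = inj₂ λ _ → proj₂ }
    perform {k} s (ownR q) e b _ with em₁ {Separation (suc k) (ΘL s) (λ V → ΘR s V × Found k (R.Answer q) V)}
    ... | no n = record
      { state = extendR s (Found-supp k (R.Answer q) (R.Answer-agree q b)) n
      ; monoL = λ _ h → h ; monoR = λ _ → proj₁ ; finished = inj₁ λ _ → proj₂ }
    ... | yes sep = record
      { state = extendR s (Empty-supp k (R.Answer q) (R.Answer-agree q b)) λ sep′ → insep s
          (drop (keep (suppL s)) (found-or-empty k (R.Answer q) (R.Answer-agree q b) (suppR s)) (merge-right sep sep′))
      ; monoL = λ _ h → h ; monoR = λ _ → proj₁ ; finished = inj₂ λ _ → proj₂ }
    perform {k} s (comL T u t) e b h = record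
      { state = extend s (NewIsL-supp u bu) (NewInR-supp t bt) (common-left s e u t bu bt h)
      ; monoL = λ _ → proj₁ ; monoR = λ _ → proj₁ ; finished = (λ _ → proj₂) , (λ _ → proj₂) }
      where bu = m⊔n≤o⇒m≤o (LS.bound u) (boundC t) b
            bt = m⊔n≤o⇒n≤o (LS.bound u) (boundC t) b
    perform {k} s (comR T u t) e b h = record
      { state = extend s (NewInL-supp t bt) (NewIsR-supp u bu) (common-right s e u t bu bt h)
      ; monoL = λ _ → proj₁ ; monoR = λ _ → proj₁ ; finished = (λ _ → proj₂) , (λ _ → proj₂) }
      where bu = m⊔n≤o⇒m≤o (RS.bound u) (boundC t) b
            bt = m⊔n≤o⇒n≤o (RS.bound u) (boundC t) b
    perform {k} s (aim y) e b _
      with em₁ {Separation (suc k) (λ V → ΘL s V × GoalL k true V) (λ V → ΘR s V × GoalR k true y V)}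
    ... | no n = record
      { state = extend s (GoalL-supp k true) (GoalR-supp k true y b) n
      ; monoL = λ _ → proj₁ ; monoR = λ _ → proj₁ ; finished = true , (λ _ → proj₂) , (λ _ → proj₂) }
    ... | yes sep = record
      { state = extend s (GoalL-supp k false) (GoalR-supp k false y b)
          λ sep′ → rule s e y b λ { true → sep ; false → sep′ }
      ; monoL = λ _ → proj₁ ; monoR = λ _ → proj₁ ; finished = false , (λ _ → proj₂) , (λ _ → proj₂) }

    Finished : ∀ {k} → State k → State (suc k) → Set₁
    Finished {k} s s′ = ∀ p → task k ≡ just p → τ k ≡ taskTy p → taskBound p ≤ k → Ready s p → Done s′ p

    advance : ∀ {k} (s : State k) → Extension s (Finished s)
    advance {k} s with task k
    ... | nothing = record { state = idle s ; monoL = λ _ h → h ; monoR = λ _ h → h ; finished = λ _ () }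
    ... | just p with em₁ {τ k ≡ taskTy p × taskBound p ≤ k × Ready s p}
    ...   | yes (e , b , r) = let x = perform s p e b r in record
      { state = state x ; monoL = monoL x ; monoR = monoR x ; finished = λ { _ refl _ _ _ → finished x } }
    ...   | no n = record { state = idle s ; monoL = λ _ h → h ; monoR = λ _ h → h
                          ; finished = λ { _ refl e b r → ⊥-elim (n (e , b , r)) } }

    stage : ∀ k → State k
    stage zero = record
      { ΘL = λ V → SatF φL (env V) ; ΘR = λ V → SatF φR (env V)
      ; suppL = λ V W a h → subst (SatF φL) (proj₁ a) h ; suppR = λ V W a h → subst (SatF φR) (proj₁ a) h
      ; soundL = λ _ h → h ; insep = initial }
    stage (suc k) = state (advance (stage k))

    ΨL : ℕ → ΘLeft
    ΨL k = ΘL (stage k)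

    ΨR : ℕ → ΘRight
    ΨR k = ΘR (stage k)

    -- Inseparability contains consistency: the false condition separates an inconsistent left side,
    -- the true condition an inconsistent right side.
    consistentL : ∀ k → ¬ (∀ V → ¬ ΨL k V)
    consistentL k n = insep (stage k) record
      { θ = ∅ ; E = ∅ ; left = λ V h → ⊥-elim (n V h) ; right = λ _ _ () }

    consistentR : ∀ k → ¬ (∀ V → ¬ ΨR k V)
    consistentR k n = insep (stage k) record
      { θ = sng ⟨⟩ ; E = ∅ ; left = λ _ _ → inj₁ (toSmall (lift tt)) ; right = λ V h → ⊥-elim (n V h) }

    module ML = L.Model 0 ΨL (λ k → monoL (advance (stage k))) consistentL
    module MR = R.Model 1 ΨR (λ k → monoR (advance (stage k))) consistentR

    -- The schedule repeats every task beyond any bound, so some occurrence comes after the task is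
    -- ready and its terms are available.
    eventually : ∀ p K → (∀ k → K ≤ k → Ready (stage k) p) → Σ ℕ λ k → τ k ≡ taskTy p × Done (stage (suc k)) p
    eventually p K ready with scheduled p (K ⊔ taskBound p)
    ... | k , K≤k , e , f = k , e , finished (advance (stage k)) p f e
      (≤-trans (m≤n⊔m K (taskBound p)) K≤k) (ready k (≤-trans (m≤m⊔n K (taskBound p)) K≤k))

    answersL : ∀ q → (Σ (LS.Trm (L.tyQ q)) λ u → ML.⊩ λ V → L.Answer q (L.evT u V) V) ⊎
                     (ML.⊩ λ V → ∀ x → ¬ L.Answer q x V)
    answersL q with eventually (ownL q) 0 (λ _ _ → lift tt)
    ... | k , _ , inj₁ h = inj₁ (LS.new false k , suc k , h)
    ... | k , _ , inj₂ h = inj₂ (suc k , h)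

    answersR : ∀ q → (Σ (RS.Trm (R.tyQ q)) λ u → MR.⊩ λ V → R.Answer q (R.evT u V) V) ⊎
                     (MR.⊩ λ V → ∀ x → ¬ R.Answer q x V)
    answersR q with eventually (ownR q) 0 (λ _ _ → lift tt)
    ... | k , _ , inj₁ h = inj₁ (RS.new false k , suc k , h)
    ... | k , _ , inj₂ h = inj₂ (suc k , h)

    module TL = ML.Truth answersL
    module TR = MR.Truth answersR

    -- Agreement of the two models on the common part

    commonL : ∀ {T} (u : LS.Trm T) (t : CT (set T)) → ML.⊩ u ML.∈̇ LS.embed t →
      Σ (CT T) λ w → (ML.⊩ LS.embed w ML.≐ u) × (MR.⊩ RS.embed w MR.∈̇ RS.embed t)
    commonL {T} u t (K , h) with eventually (comL T u t) K
      (λ k K≤k V θ → lower (h V (ML.Θ-mono (≤⇒≤′ K≤k) V θ)))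
    ... | k , e , d , m = new k e , (suc k , d) , (suc k , m)

    commonR : ∀ {T} (u : RS.Trm T) (t : CT (set T)) → MR.⊩ u MR.∈̇ RS.embed t →
      Σ (CT T) λ w → (MR.⊩ RS.embed w MR.≐ u) × (ML.⊩ LS.embed w ML.∈̇ LS.embed t)
    commonR {T} u t (K , h) with eventually (comR T u t) K
      (λ k K≤k V θ → lower (h V (MR.Θ-mono (≤⇒≤′ K≤k) V θ)))
    ... | k , e , d , m = new k e , (suc k , d) , (suc k , m)

    eqB-intro : ∀ {Γ T} (u w : NRC Γ T) ρ → Eq T (ev u ρ) (ev w ρ) → Holds (eqB u w) ρ
    eqB-intro {T = T} u w ρ e = toSmall (lift tt) , λ p → let (x , (m , n) , _) = fromSmall p in
      n (toSmall (Eq-trans T (Eq-sym T e) (fromSmall m)))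

    eqB-elim : ∀ {Γ T} (u w : NRC Γ T) ρ → Holds (eqB u w) ρ → Eq T (ev u ρ) (ev w ρ)
    eqB-elim {T = T} u w ρ (_ , n) = stable λ ne → n (toSmall
      (ev u ρ , (toSmall (Eq-refl T) , λ p → ne (Eq-sym T (fromSmall p))) , toSmall (lift tt)))

    module _ (w w′ : CT ur) where
      private
        side₁ : ∀ {k} → boundC w ⊔ boundC w′ ≤ k → boundC w ≤ k
        side₁ = m⊔n≤o⇒m≤o (boundC w) (boundC w′)

        side₂ : ∀ {k} → boundC w ⊔ boundC w′ ≤ k → boundC w′ ≤ k
        side₂ = m⊔n≤o⇒n≤o (boundC w) (boundC w′)

        equation : ∀ k → boundC w ⊔ boundC w′ ≤ k → NRC (ctx k) (set unit)
        equation k b = eqB (toNRC w (side₁ b)) (toNRC w′ (side₂ b))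

        introL : ∀ k b V → (LS.embed w ML.≐ LS.embed w′) V → Holds (equation k b) (L.commonEnv k V)
        introL k b V e = eqB-intro (toNRC w (side₁ b)) (toNRC w′ (side₂ b)) (L.commonEnv k V)
          (subst₂ (Eq ur) (sym (L.ev-toNRC w (side₁ b) V)) (sym (L.ev-toNRC w′ (side₂ b) V)) e)

        elimL : ∀ k b V → Holds (equation k b) (L.commonEnv k V) → (LS.embed w ML.≐ LS.embed w′) V
        elimL k b V h = subst₂ (Eq ur) (L.ev-toNRC w (side₁ b) V) (L.ev-toNRC w′ (side₂ b) V)
          (eqB-elim (toNRC w (side₁ b)) (toNRC w′ (side₂ b)) (L.commonEnv k V) h)

        introR : ∀ k b V → (RS.embed w MR.≐ RS.embed w′) V → Holds (equation k b) (R.commonEnv k V)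
        introR k b V e = eqB-intro (toNRC w (side₁ b)) (toNRC w′ (side₂ b)) (R.commonEnv k V)
          (subst₂ (Eq ur) (sym (R.ev-toNRC w (side₁ b) V)) (sym (R.ev-toNRC w′ (side₂ b) V)) e)

        elimR : ∀ k b V → Holds (equation k b) (R.commonEnv k V) → (RS.embed w MR.≐ RS.embed w′) V
        elimR k b V h = subst₂ (Eq ur) (R.ev-toNRC w (side₁ b) V) (R.ev-toNRC w′ (side₂ b) V)
          (eqB-elim (toNRC w (side₁ b)) (toNRC w′ (side₂ b)) (R.commonEnv k V) h)

        module _ (K K′ : ℕ) where
          top-stage : ℕ
          top-stage = (K ⊔ K′) ⊔ (boundC w ⊔ boundC w′)

          ≤₁ : K ≤ top-stage
          ≤₁ = ≤-trans (m≤m⊔n K K′) (m≤m⊔n (K ⊔ K′) _)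

          ≤₂ : K′ ≤ top-stage
          ≤₂ = ≤-trans (m≤n⊔m K K′) (m≤m⊔n (K ⊔ K′) _)

          ≤₃ : boundC w ⊔ boundC w′ ≤ top-stage
          ≤₃ = m≤n⊔m (K ⊔ K′) _

      -- The right side decides the equation by `eqQ`. Had it decided against, the equation itself,
      -- as an NRC condition, would separate the two sides.
      ≐-L⇒R : ML.⊩ LS.embed w ML.≐ LS.embed w′ → MR.⊩ RS.embed w MR.≐ RS.embed w′
      ≐-L⇒R (K , h) with answersR (RS.eqQ (RS.embed w) (RS.embed w′))
      ... | inj₁ (_ , g) = MR.⊩-mono g λ V e → ≡⇒Eq {ur} e
      ... | inj₂ (K′ , g) = ⊥-elim (insep (stage k) record
        { θ = equation k b ; E = ∅
        ; left = λ V θ → inj₁ (introL k b V (h V (ML.Θ-mono (≤⇒≤′ (≤₁ K K′)) V θ)))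
        ; right = λ V θ p → g V (MR.Θ-mono (≤⇒≤′ (≤₂ K K′)) V θ) (lift tt) (cong lift (lower (elimR k b V p))) })
        where k = top-stage K K′
              b = ≤₃ K K′

      ≐-R⇒L : MR.⊩ RS.embed w MR.≐ RS.embed w′ → ML.⊩ LS.embed w ML.≐ LS.embed w′
      ≐-R⇒L (K , h) with answersL (LS.eqQ (LS.embed w) (LS.embed w′))
      ... | inj₁ (_ , g) = ML.⊩-mono g λ V e → ≡⇒Eq {ur} e
      ... | inj₂ (K′ , g) = ⊥-elim (insep (stage k) record
        { θ = notB (equation k b) ; E = ∅
        ; left = λ V θ → inj₁ (toSmall (lift tt) , λ p →
            g V (ML.Θ-mono (≤⇒≤′ (≤₂ K K′)) V θ) (lift tt) (cong lift (lower (elimL k b V p))))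
        ; right = λ V θ (_ , n) → n (introR k b V (h V (MR.Θ-mono (≤⇒≤′ (≤₁ K K′)) V θ))) })
        where k = top-stage K K′
              b = ≤₃ K K′

    -- Both sides entail the same equations between common terms, so the least common code of `w` is
    -- the same on both; it exists since `w` names itself.
    atom-common : ∀ (w : CT ur) → ML.atom (LS.embed w) ≡ MR.atom (RS.embed w)
    atom-common w with ML.atomCode (LS.embed w) | MR.atomCode (RS.embed w)
    ... | _ , inj₂ (n , _) | _ = ⊥-elim (n (_ , w , refl , 0 , λ _ _ → Eq-refl ur))
    ... | _ , inj₁ _ | _ , inj₂ (n , _) = ⊥-elim (n (_ , w , refl , 0 , λ _ _ → Eq-refl ur))
    ... | _ , inj₁ (m , refl , l) | _ , inj₁ (m′ , refl , l′) = cong (λ n → Injection.to ι (pr 0 n))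
      (least-unique (λ _ (v , c , h) → v , c , ≐-L⇒R w v h) (λ _ (v , c , h) → v , c , ≐-R⇒L w v h) l l′)

    collapse-common : ∀ {T} (w : CT T) → Eq T (ML.collapse (LS.embed w)) (MR.collapse (RS.embed w))
    collapse-common {ur} w    = lift (atom-common w)
    collapse-common {unit} w  = lift tt
    collapse-common {T ⊗ S} w = collapse-common (π₁ w) , collapse-common (π₂ w)
    collapse-common {set T} t x = forth , back
      where
      forth : x ∈ ML.collapse (LS.embed t) → x ∈ MR.collapse (RS.embed t)
      forth p with u , h , e ← ML.∈-collapse {t = LS.embed t} p
              with w , d , m ← commonL u t h =
        proj₂ (MR.collapse (RS.embed t)) _ _
          (Eq-trans T (Eq-sym T (collapse-common w)) (Eq-trans T (ML.collapse-cong (LS.embed w) u d) e))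
          (MR.collapse-∈ (RS.embed w) (RS.embed t) m)
      back : x ∈ MR.collapse (RS.embed t) → x ∈ ML.collapse (LS.embed t)
      back p with u , h , e ← MR.∈-collapse {t = RS.embed t} p
             with w , d , m ← commonR u t h =
        proj₂ (ML.collapse (LS.embed t)) _ _
          (Eq-trans T (collapse-common w) (Eq-trans T (MR.collapse-cong (RS.embed w) u d) e))
          (ML.collapse-∈ (LS.embed w) (LS.embed t) m)

    -- Without a common name, x has an atom with first code component 1, while atoms of the right
    -- have 0 or 2.
    atom-own : ∀ (x : LS.Trm ur) (y : RS.Trm ur) → (∀ (w : CT ur) → ¬ (ML.⊩ x ML.≐ LS.embed w)) →
      ML.atom x ≢ MR.atom y
    atom-own x y n e with ML.atomCode x | MR.atomCode y | Injection.injective ι e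
    ... | _ , inj₁ (m , refl , (w , _ , h) , _) | _ | _ = n w h
    ... | _ , inj₂ (_ , m , refl , _) | _ , inj₁ (m′ , refl , _) | e′
      with () ← cong proj₁ (pr-injective {1} {m} {0} {m′} e′)
    ... | _ , inj₂ (_ , m , refl , _) | _ , inj₂ (_ , m′ , refl , _) | e′
      with () ← cong proj₁ (pr-injective {1} {m} {2} {m′} e′)

    aimed : ∀ y {P : Set} →
      (∀ b (w : CT S) → (ML.⊩ λ V → onL b (L.evT (LS.embed w) V) (env V)) →
                        (MR.⊩ λ V → onR b (R.evT (RS.embed w) V) (R.evT y V)) → P) → P
    aimed y f with eventually (aim y) 0 (λ _ _ → lift tt)
    ... | k , e , b , hL , hR = f b (new k e) (suc k , hL) (suc k , hR)

    ρL : Env ΔL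
    ρL = TL.collapseS (LS.tabulate LS.base)

    ρR : Env ΔR
    ρR = TR.collapseS (RS.tabulate RS.base)

    satL : SatF φL ρL
    satL = TL.truth φL (λ p → p) (LS.tabulate LS.base)
      (0 , λ V h → subst (SatF φL) (sym (L.evS-tabulate LS.base V (env V) λ _ → refl)) h)

    satR : SatF φR ρR
    satR = TR.truth φR (λ p → p) (RS.tabulate RS.base)
      (0 , λ V h → subst (SatF φR) (sym (R.evS-tabulate RS.base V (env V) λ _ → refl)) h)

    lookup-ρL : ∀ {T} (i : ΔL ∋ T) → lookup ρL i ≡ ML.collapse (LS.base i)
    lookup-ρL i = trans (TL.lookup-collapseS (LS.tabulate LS.base) i) (cong ML.collapse (LS.get-tabulate LS.base i))

    lookup-ρR : ∀ {T} (i : ΔR ∋ T) → lookup ρR i ≡ MR.collapse (RS.base i)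
    lookup-ρR i = trans (TR.lookup-collapseS (RS.tabulate RS.base) i) (cong MR.collapse (RS.get-tabulate RS.base i))

    common-agree : ∀ {T} (i : Γ ∋ T) → Eq T (lookup ρL (rL i)) (lookup ρR (rR i))
    common-agree {T} i = subst₂ (Eq T) (sym (lookup-ρL (rL i))) (sym (lookup-ρR (rR i))) (collapse-common (base i))

    not-member : ∀ {T} (x : ΔL ∋ T) (b : ΔR ∋ set T) →
      (∀ y → ¬ Eq T (ML.collapse (LS.base x)) (MR.collapse y)) → ¬ (lookup ρL x ∈ lookup ρR b)
    not-member {T} x b n m
      with y , _ , e ← MR.∈-collapse {t = RS.base b}
        (∈-resp {T} {s = lookup ρR b} {MR.collapse (RS.base b)} (≡⇒Eq {T} (lookup-ρL x)) (≡⇒Eq {set T} (lookup-ρR b)) m) =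
      n y (Eq-sym T e)

    differ-L : ∀ {T} (w : CT T) (x : LS.Trm (set T)) (y : RS.Trm (set T)) (P : Val ΔL → Set) →
      (ML.⊩ λ V → Lift (lsuc 0ℓ) (P V × L.evT (LS.embed w) V ∈ L.evT x V)) → (MR.⊩ λ V → Lift (lsuc 0ℓ) (¬ (R.evT (RS.embed w) V ∈ R.evT y V))) →
      ¬ Eq (set T) (ML.collapse x) (MR.collapse y)
    differ-L {T} w x y P h g e = MR.⊩-consistent
      (MR.⊩-∧ g (TR.∈-collapse-inverse (RS.embed w) y
        (∈-resp {T} {s = ML.collapse x} {MR.collapse y} (collapse-common w) e (ML.collapse-∈ (LS.embed w) x (ML.⊩-mono h λ V (lift (_ , m)) → lift m)))))
      λ V (lift n , lift m) → n m

    differ-R : ∀ {T} (w : CT T) (x : LS.Trm (set T)) (y : RS.Trm (set T)) (P : Val ΔL → Set) →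
      (ML.⊩ λ V → Lift (lsuc 0ℓ) (P V × ¬ (L.evT (LS.embed w) V ∈ L.evT x V))) → MR.⊩ RS.embed w MR.∈̇ y →
      ¬ Eq (set T) (ML.collapse x) (MR.collapse y)
    differ-R {T} w x y P g h e = ML.⊩-consistent
      (ML.⊩-∧ g (TL.∈-collapse-inverse (LS.embed w) x
        (∈-resp {T} {s = MR.collapse y} {ML.collapse x} (Eq-sym T (collapse-common w))
          (Eq-sym (set T) {ML.collapse x} {MR.collapse y} e) (MR.collapse-∈ (RS.embed w) y h))))
      λ V (lift (_ , n) , lift m) → n m

-- Collection, interpolation and explicit definitions

module Definability
    (em₀ : ExcludedMiddle 0ℓ) (em₁ : ExcludedMiddle (lsuc 0ℓ))
    (U : Set) (ι : ℕ ↣ U) (dflt : (T : Ty) → Sem.⟦_⟧ U T) where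
  open Valuations em₀ em₁ U ι dflt

  -- A stage number encodes a type, a slot and a padding number. The padding makes every pair of
  -- type and slot recur at arbitrarily late stages; numbers that code no type default to `unit`.
  τ : ℕ → Ty
  τ k = fromMaybe unit (decode (λ T → ⌜ codeTy T ⌝) (proj₁ (unpair k)))

  slot : ℕ → ℕ
  slot k = proj₁ (unpair (proj₂ (unpair k)))

  fair : ∀ T n K → Σ ℕ λ k → K ≤ k × τ k ≡ T × slot k ≡ n
  fair T n K = k , ≤-trans K≤m m≤k ,
    trans (cong (λ p → fromMaybe unit (decode _ (proj₁ p))) (unpair-pr ⌜ codeTy T ⌝ m))
          (cong (fromMaybe unit) (decode-code _ (λ a b e → codeTy-injective a b (⌜⌝-injective _ _ e)) T)) ,
    trans (cong (λ p → proj₁ (unpair (proj₂ p))) (unpair-pr ⌜ codeTy T ⌝ m)) (cong proj₁ (unpair-pr n K))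
    where
    m = pr n K
    k = pr ⌜ codeTy T ⌝ m
    K≤m : K ≤ m
    K≤m = subst (_≤ m) (cong proj₂ (unpair-pr n K)) (proj₂ (unpair-≤ m))
    m≤k : m ≤ k
    m≤k = subst (_≤ k) (cong proj₂ (unpair-pr ⌜ codeTy T ⌝ m)) (proj₂ (unpair-≤ k))

  Matching : ∀ {Γ ΔL ΔR} → (∀ {T} → Γ ∋ T → ΔL ∋ T) → (∀ {T} → Γ ∋ T → ΔR ∋ T) → Env ΔL → Env ΔR → Set₁
  Matching {Γ} rL rR ρL ρR = ∀ {T} (i : Γ ∋ T) → Eq T (lookup ρL (rL i)) (lookup ρR (rR i))

  valuation : ∀ {Δ} → Env Δ → Val Δ
  valuation ρ = val⟨ ρ , (λ _ T _ → dflt T) ⟩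

  ∈-filter : ∀ {Γ S} (c : NRC Γ (set S)) θ ρ {x} → x ∈ ev c ρ → Holds θ (x , ρ) → x ∈ ev (filter c θ) ρ
  ∈-filter {S = S} c θ ρ {x} m h = toSmall (x , m , toSmall (lift tt , h , toSmall (Eq-refl S)))

  filter-∈ : ∀ {Γ S} (c : NRC Γ (set S)) θ ρ {y} → y ∈ ev (filter c θ) ρ →
    Σ _ λ x → x ∈ ev c ρ × Holds θ (x , ρ) × Eq S x y
  filter-∈ c θ ρ p with x , m , q ← fromSmall p with _ , h , e ← fromSmall q = x , m , h , fromSmall e

  module Sides (Γ ΔL ΔR : Ctx) (rL : ∀ {T} → Γ ∋ T → ΔL ∋ T) (rR : ∀ {T} → Γ ∋ T → ΔR ∋ T)
               (φL : Fm ΔL) (φR : Fm ΔR) where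
    open Common τ Γ

    module Covering (T : Ty) (Target : Env ΔL → ⟦ T ⟧ → Set₁) =
      Amalgamation em₀ em₁ U ι dflt τ slot fair Γ ΔL ΔR rL rR φL φR T Target

    SepResult : (T : Ty) → (Env ΔL → ⟦ T ⟧ → Set₁) → Set₁
    SepResult T Target = Covering.Separation T Target 0 (λ V → SatF φL (env V)) (λ V → SatF φR (env V))

    -- A separation at stage 0 with an empty target: nothing can be covered, so its condition alone
    -- separates the formulas.
    interpolation : (∀ ρL ρR → Matching rL rR ρL ρR → SatF φL ρL → ¬ SatF φR ρR) →
      Σ (NRC Γ (set unit)) λ θ →
        (∀ ρ → SatF φL ρ → Holds θ (restrict rL ρ)) × (∀ ρ → SatF φR ρ → ¬ Holds θ (restrict rR ρ))
    interpolation inconsistent = θ sep ,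
      (λ ρ h → [ (λ p → p) , (λ ()) ]′ (left sep (valuation ρ) h)) , λ ρ h → right sep (valuation ρ) h
      where
      open Covering unit (λ _ _ → Lift _ ⊥)
      open Separation
      sep : Separation 0 (λ V → SatF φL (env V)) (λ V → SatF φR (env V))
      sep = stable λ n → let open Limit noGoal n in inconsistent ρL ρR common-agree satL satR

    Collects : ∀ {T} → ΔL ∋ T → NRC Γ (set T) → Set₁
    Collects {T} x E = ∀ ρL ρR γ → Restricts rL ρL γ → Restricts rR ρR γ → SatF φL ρL → SatF φR ρR →
      lookup ρL x ∈ ev E γ

    -- This hypothesis is tested on the two collapses, which agree on Γ only up to `Eq`; hence
    -- `Matching` instead of the strict `Restricts`.
    Member : ∀ {T} → ΔL ∋ T → ΔR ∋ set T → Set₁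
    Member x b = ∀ ρL ρR → Matching rL rR ρL ρR → SatF φL ρL → SatF φR ρR → lookup ρL x ∈ lookup ρR b

    collects : ∀ {T} (x : ΔL ∋ T) → SepResult T (λ ρ z → Eq T z (lookup ρ x)) → Σ (NRC Γ (set T)) (Collects x)
    collects {T} x sep = E sep , covered
      where
      open Covering T (λ ρ z → Eq T z (lookup ρ x))
      open Separation
      covered : Collects x (E sep)
      covered ρL ρR γ gL gR hL hR with left sep (valuation ρL) hL
      ... | inj₁ p = ⊥-elim (right sep (valuation ρR) hR
        (subst (Holds (θ sep)) (trans (sym (restrict-unique rL ρL γ gL)) (restrict-unique rR ρR γ gR)) p))
      ... | inj₂ (z , lift m , q) = proj₂ (ev (E sep) γ) z _ q
        (subst (λ ρ → z ∈ ev (E sep) ρ) (sym (restrict-unique rL ρL γ gL)) m)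

    collect-ur : ∀ (x : ΔL ∋ ur) (b : ΔR ∋ set ur) → Member x b → Σ (NRC Γ (set ur)) (Collects x)
    collect-ur x b member = collects x (stable absurd)
      where
      open Covering ur (λ ρ z → Eq ur z (lookup ρ x))
      absurd : ¬ ¬ SepResult ur (λ ρ z → Eq ur z (lookup ρ x))
      absurd n = not-member x b (λ y e → atom-own (LS.base x) y not-common (lower e))
        (member ρL ρR common-agree satL satR)
        where
        open Limit noGoal n
        not-common : ∀ w → ¬ (ML.⊩ LS.base x ML.≐ LS.embed w)
        not-common w (K , h) = State.insep (stage k) record
          -- Were x entailed to equal a common term w, the singleton {w} would cover x on the left.
          { θ = ∅ ; E = sng (toNRC w b≤k)
          ; left = λ V θ → inj₂ (L.evT (LS.embed w) V , lift (toSmall (≡⇒Eq {ur} (L.ev-toNRC w b≤k V))) ,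
              Eq-sym ur (h V (ML.Θ-mono (≤⇒≤′ (m≤m⊔n K (boundC w))) V θ)))
          ; right = λ _ _ () }
          where k = K ⊔ boundC w
                b≤k = m≤n⊔m K (boundC w)

    -- If x agrees with y on c, both are {z ∈ c | θ₁ z}; any z ∈ c on which they could
    -- still disagree is caught by θ₁ ∧ θ₂.
    set-rule : ∀ S (x : ΔL ∋ set S) (c : Γ ∋ set S) →
      (∀ ρ → SatF φL ρ → ∀ z → z ∈ lookup ρ x → z ∈ lookup ρ (rL c)) →
      let open Covering (set S) (λ ρ z → Eq (set S) z (lookup ρ x)) in
      ∀ {k} (s : State k) → τ k ≡ S → (y : RS.Trm (set S)) → RS.bound y ≤ k →
      Separation (suc k)
        (λ V → State.ΘL s V × Lift (lsuc 0ℓ) (at V true S k ∈ lookup (env V) (rL c) × at V true S k ∈ lookup (env V) x))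
        (λ V → State.ΘR s V × Lift (lsuc 0ℓ) (¬ (at V true S k ∈ R.evT y V))) →
      Separation (suc k)
        (λ V → State.ΘL s V × Lift (lsuc 0ℓ) (at V true S k ∈ lookup (env V) (rL c) × ¬ (at V true S k ∈ lookup (env V) x)))
        (λ V → State.ΘR s V × Lift (lsuc 0ℓ) (at V true S k ∈ R.evT y V)) → ⊥
    set-rule S x c x⊆c {k} s refl y b≤k s₁ s₂ = State.insep s record
      { θ = anyB cN (andB (θ s₁) (θ s₂))
      -- Either `E s₁` or `E s₂` covers x for some z in c, or x is itself the subset of c cut out by
      -- `θ s₁`, which enters as one further candidate.
      ; E = union (sng (filter cN (θ s₁))) (bigU (union (E s₁) (E s₂)) cN)
      ; left = split
      ; right = λ V h p → let (z , m , q) = fromSmall p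
                              (q₁ , q₂) = andB-Holds (θ s₁) (θ s₂) (z , R.commonEnv k V) q in
          refute V h z q₁ q₂
      }
      where
      open Covering (set (τ k)) (λ ρ z → Eq (set (τ k)) z (lookup ρ x))
      open Separation
      cN : NRC (ctx k) (set (τ k))
      cN = var (weaken k c)
      -- On the right, z ∉ y refutes `θ s₁` and z ∈ y refutes `θ s₂`, so the two conditions never
      -- hold together.
      refute : ∀ V → State.ΘR s V → ∀ z → Holds (θ s₁) (z , R.commonEnv k V) → ¬ Holds (θ s₂) (z , R.commonEnv k V)
      refute V h z q₁ q₂ with em₀ {z ∈ R.evT y V}
      ... | no n = right-upd s₁ {z} {unit} {lift tt} {V} (upd-supp {Θ = State.ΘR s} (State.suppR s) {V} {z} {unit} {lift tt} h ,
        lift λ m → n (subst₂ _∈_ (new-≡ V) (sym (evT-updR y b≤k V)) m)) q₁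
      ... | yes m = right-upd s₂ {z} {unit} {lift tt} {V} (upd-supp {Θ = State.ΘR s} (State.suppR s) {V} {z} {unit} {lift tt} h ,
        lift (subst₂ _∈_ (sym (new-≡ V)) (evT-updR y b≤k V) m)) q₂
      split : ∀ V → State.ΘL s V → Holds (anyB cN (andB (θ s₁) (θ s₂))) (L.commonEnv k V) ⊎
        Covers (ev (union (sng (filter cN (θ s₁))) (bigU (union (E s₁) (E s₂)) cN)) (L.commonEnv k V)) (env V)
      split V h with em₁ {Covers (ev (bigU (union (E s₁) (E s₂)) cN) (L.commonEnv k V)) (env V)}
                   | em₁ {Lift (lsuc 0ℓ) (Holds (anyB cN (andB (θ s₁) (θ s₂))) (L.commonEnv k V))}
      ... | yes (z , lift m , e) | _ = inj₂ (z , lift (inj₂ m) , e)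
      ... | no _ | yes (lift p) = inj₁ p
      ... | no n | no ¬p = inj₂ (ev (filter cN (θ s₁)) γ , lift (inj₁ (toSmall (Eq-refl (set (τ k)) {ev (filter cN (θ s₁)) γ}))) ,
          λ z → forth z , back z)
        where
        γ = L.commonEnv k V
        X = lookup (env V) x
        in-c : ∀ z → z ∈ ev cN γ → z ∈ lookup (env V) (rL c)
        in-c z = subst (z ∈_) (L.lookup-weaken k c V)
        uncovered : ∀ z → z ∈ ev cN γ → ¬ (Covers (ev (E s₁) (z , γ)) (env V) ⊎ Covers (ev (E s₂) (z , γ)) (env V))
        uncovered z m (inj₁ (w , lift q , e)) = n (w , lift (toSmall (z , m , inj₁ q)) , e)
        uncovered z m (inj₂ (w , lift q , e)) = n (w , lift (toSmall (z , m , inj₂ q)) , e)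
        positive : ∀ z → z ∈ ev cN γ → z ∈ X → Holds (θ s₁) (z , γ)
        positive z m p = [ (λ q → q) , (λ q → ⊥-elim (uncovered z m (inj₁ q))) ]′
          (left-upd s₁ {z} {unit} {lift tt} {V} (upd-supp {Θ = State.ΘL s} (State.suppL s) {V} {z} {unit} {lift tt} h ,
            lift (subst (_∈ lookup (env V) (rL c)) (sym (new-≡ V)) (in-c z m) , subst (_∈ X) (sym (new-≡ V)) p)))
        negative : ∀ z → z ∈ ev cN γ → ¬ (z ∈ X) → Holds (θ s₂) (z , γ)
        negative z m p = [ (λ q → q) , (λ q → ⊥-elim (uncovered z m (inj₂ q))) ]′
          (left-upd s₂ {z} {unit} {lift tt} {V} (upd-supp {Θ = State.ΘL s} (State.suppL s) {V} {z} {unit} {lift tt} h ,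
            lift (subst (_∈ lookup (env V) (rL c)) (sym (new-≡ V)) (in-c z m) , λ q → p (subst (_∈ X) (new-≡ V) q))))
        back : ∀ z → z ∈ X → z ∈ ev (filter cN (θ s₁)) γ
        back z p = ∈-filter cN (θ s₁) γ m (positive z m p)
          where m = subst (z ∈_) (sym (L.lookup-weaken k c V)) (x⊆c (env V) (State.soundL s V h) z p)
        forth : ∀ z → z ∈ ev (filter cN (θ s₁)) γ → z ∈ X
        forth z p with w , m , q , e ← filter-∈ cN (θ s₁) γ p with em₀ {w ∈ X}
        ... | yes r = proj₂ X w z e r
        -- A w in c outside x satisfies `θ s₂`; with `θ s₁` it would witness the existential
        -- condition, which was assumed to fail.
        ... | no ¬r = ⊥-elim (¬p (lift (toSmall (w , m , Holds-andB (θ s₁) (θ s₂) (w , γ) q (negative w m ¬r)))))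

    -- The goal gives, for each right term y, a common constant on which x and y are entailed to
    -- differ. Hence no element of b on the right collapses to x, against `Member`.
    collect-set : ∀ {S} (x : ΔL ∋ set S) (b : ΔR ∋ set (set S)) (c : Γ ∋ set S) →
      (∀ ρ → SatF φL ρ → ∀ z → z ∈ lookup ρ x → z ∈ lookup ρ (rL c)) →
      Member x b → Σ (NRC Γ (set (set S))) (Collects x)
    collect-set {S} x b c x⊆c member = collects x (stable absurd)
      where
      open Covering (set S) (λ ρ z → Eq (set S) z (lookup ρ x))
      distinguish : Goal
      distinguish = record
        { S = S ; Y = set S
        ; onL = λ { true z ρ → Lift _ (z ∈ lookup ρ (rL c) × z ∈ lookup ρ x)
                  ; false z ρ → Lift _ (z ∈ lookup ρ (rL c) × ¬ (z ∈ lookup ρ x)) }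
        ; onR = λ { true z y → Lift _ (¬ (z ∈ y)) ; false z y → Lift _ (z ∈ y) }
        ; rule = λ s e y b≤k sep → set-rule S x c x⊆c s e y b≤k (sep true) (sep false)
        }
      absurd : ¬ ¬ SepResult (set S) (λ ρ z → Eq (set S) z (lookup ρ x))
      absurd n = not-member x b different (member ρL ρR common-agree satL satR)
        where
        open Limit distinguish n
        different : ∀ y → ¬ Eq (set S) (ML.collapse (LS.base x)) (MR.collapse y)
        different y e = aimed y λ
          { true w hL hR  → differ-L w (LS.base x) y (λ V → L.evT (LS.embed w) V ∈ lookup (env V) (rL c)) hL hR e
          ; false w hL hR → differ-R w (LS.base x) y (λ V → L.evT (LS.embed w) V ∈ lookup (env V) (rL c)) hL hR e }

  open Sides using (Collects; Member)

  -- Contexts and formulas are quantified because the induction on the type adds variables to both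
  -- sides and, at products and sets, to Γ.
  Collectible : Ty → Set₁
  Collectible T = ∀ {Γ ΔL ΔR} (rL : ∀ {T} → Γ ∋ T → ΔL ∋ T) (rR : ∀ {T} → Γ ∋ T → ΔR ∋ T)
    (φL : Fm ΔL) (φR : Fm ΔR) (x : ΔL ∋ T) (b : ΔR ∋ set T) →
    Member Γ ΔL ΔR rL rR φL φR x b → Σ (NRC Γ (set T)) (Collects Γ ΔL ΔR rL rR φL φR x)

  collect : ∀ T → Collectible T
  collect ur rL rR φL φR x b member = Sides.collect-ur _ _ _ rL rR φL φR x b member
  collect unit rL rR φL φR x b member = sng ⟨⟩ , λ _ _ _ _ _ _ _ → toSmall (lift tt)
  collect (T ⊗ S) {Γ} {ΔL} {ΔR} rL rR φL φR x b member =
    bigU (bigU (sng (pair (var (there here)) (var here))) E₂) E₁ ,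
    λ ρL ρR γ gL gR hL hR → let p = lookup ρL x in
      toSmall (proj₁ p ,
        -- The added variable of the right side need only contain the relevant components, so `univ`
        -- is an admissible value for it.
        C₁ (proj₁ p , ρL) (univ , ρR) γ gL gR (hL , Eq-refl T) (hR , λ _ _ → lift tt) ,
        toSmall (proj₂ p ,
          C₂ (proj₂ p , proj₁ p , ρL) (univ , proj₁ p , ρR) (proj₁ p , γ)
            (λ { here → refl ; (there i) → gL i }) (λ { here → refl ; (there i) → gR i })
            (hL , Eq-refl S) (hR , λ _ _ → lift tt) ,
          toSmall (Eq-refl (T ⊗ S))))
    where
    rL₂ : ∀ {R} → (T ∷ Γ) ∋ R → (S ∷ T ∷ ΔL) ∋ R
    rL₂ here      = there here
    rL₂ (there i) = there (there (rL i))
    rR₂ : ∀ {R} → (T ∷ Γ) ∋ R → (set S ∷ T ∷ ΔR) ∋ R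
    rR₂ here      = there here
    rR₂ (there i) = there (there (rR i))
    first = collect T {Γ} {T ∷ ΔL} {set T ∷ ΔR} (λ i → there (rL i)) (λ i → there (rR i))
      (and (wk φL) (eq (var here) (π₁ (var (there x)))))
      (and (wk φR) (all (var (there b)) (mem (π₁ (var here)) (var (there here)))))
      here here
      λ (z , ρL) (w , ρR) e (hL , q) (hR , h) →
        proj₂ w _ _ (Eq-sym T q) (lower (h _ (member ρL ρR e hL hR)))
    -- Collected over `T ∷ Γ`, so that `E₂` can stand under the binder ranging over `E₁`.
    second = collect S {T ∷ Γ} {S ∷ T ∷ ΔL} {set S ∷ T ∷ ΔR} rL₂ rR₂
      (and (wk (wk φL)) (eq (var here) (π₂ (var (there (there x))))))
      (and (wk (wk φR)) (all (var (there (there b))) (mem (π₂ (var here)) (var (there here)))))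
      here here
      λ (z , _ , ρL) (w , _ , ρR) e (hL , q) (hR , h) →
        proj₂ w _ _ (Eq-sym S q) (lower (h _ (member ρL ρR (λ i → e (there i)) hL hR)))
    E₁ = proj₁ first
    C₁ = proj₂ first
    E₂ = proj₁ second
    C₂ = proj₂ second
  collect (set S) {Γ} {ΔL} {ΔR} rL rR φL φR x b member =
    -- A union over a singleton acts as a let: `E₂` is evaluated with its extra common variable c
    -- bound to the superset of x given by `E₁`.
    bigU E₂ (sng E₁) , λ ρL ρR γ gL gR hL hR → let c = ev E₁ γ in
      toSmall (c , toSmall (Eq-refl (set S) {c}) ,
        C₂ (c , ρL) (c , ρR) (c , γ) (λ { here → refl ; (there i) → gL i }) (λ { here → refl ; (there i) → gR i })
          (hL , λ z m → lift (C₁ (z , ρL) (univ , ρR) γ gL gR (hL , lift m) (hR , λ _ _ _ _ → lift tt))) hR)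
    where
    elements = collect S {Γ} {S ∷ ΔL} {set S ∷ ΔR} (λ i → there (rL i)) (λ i → there (rR i))
      (and (wk φL) (mem (var here) (var (there x))))
      -- The added right variable contains every element of every member of b, hence the elements of
      -- x once x ∈ b.
      (and (wk φR) (all (var (there b)) (all (var here) (mem (var here) (var (there (there here)))))))
      here here
      λ (z , ρL) (w , ρR) e (hL , lift m) (hR , h) → lower (h _ (member ρL ρR e hL hR) z m)
    E₁ = proj₁ elements
    C₁ = proj₂ elements
    rL₂ : ∀ {R} → (set S ∷ Γ) ∋ R → (set S ∷ ΔL) ∋ R
    rL₂ here      = here
    rL₂ (there i) = there (rL i)
    rR₂ : ∀ {R} → (set S ∷ Γ) ∋ R → (set S ∷ ΔR) ∋ R
    rR₂ here      = here
    rR₂ (there i) = there (rR i)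
    whole = Sides.collect-set (set S ∷ Γ) (set S ∷ ΔL) (set S ∷ ΔR) rL₂ rR₂
      (and (wk φL) (all (var (there x)) (mem (var here) (var (there here))))) (wk φR)
      (there x) (there b) here
      (λ _ (_ , h) z m → lower (h z m))
      λ (_ , ρL) (_ , ρR) e (hL , _) hR → member ρL ρR (λ i → e (there i)) hL hR
    E₂ = proj₁ whole
    C₂ = proj₂ whole

  -- From implicit to explicit definition

  module _ {Tin Tout : Ty} {As : List Ty} (φ : Δ₀ (Tin ∷ Tout ∷ As)) (implicit : ImplicitlyDefines φ) where

    -- The inputs on the two sides match only up to `Eq`, whereas implicit definability speaks of
    -- one input; `SatF-cong` moves the second copy onto the first input.
    implicit-Eq : ∀ {i i′ o o′ a a′} → Eq Tin i i′ → SatF (fromΔ₀ φ) (i , o , a) → SatF (fromΔ₀ φ) (i′ , o′ , a′) → Eq Tout o o′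
    implicit-Eq {i} {i′} {o} {o′} {a} {a′} e h h′ = implicit i o o′ a a′ (toSat φ h)
      (toSat φ (SatF-cong (fromΔ₀ φ) (EqEnv-∷ (Eq-sym Tin e) (λ j → Eq-refl _)) h′))

    -- The right copy carries an arbitrary set w containing its output o′. Implicit definability
    -- puts o into w, which is the membership that `collect` requires.
    candidates : Σ (NRC (Tin ∷ []) (set Tout)) λ E → ∀ i o a → Sat φ (i , o , a) → o ∈ ev E (i , _)
    candidates = proj₁ result , λ i o a h →
      proj₂ result (i , o , a) (univ , i , o , a) (i , _) (λ { here → refl }) (λ { here → refl }) (fromSat φ h) (fromSat φ h , lift tt)
      where
      rL : ∀ {T} → (Tin ∷ []) ∋ T → (Tin ∷ Tout ∷ As) ∋ T
      rL here = here
      rR : ∀ {T} → (Tin ∷ []) ∋ T → (set Tout ∷ Tin ∷ Tout ∷ As) ∋ T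
      rR here = there here
      result = collect Tout rL rR (fromΔ₀ φ) (and (wk (fromΔ₀ φ)) (mem (var (there (there here))) (var here)))
        (there here) here
        λ (i , o , a) (w , i′ , o′ , a′) e h (h′ , lift m) → proj₂ w _ _ (Eq-sym Tout (implicit-Eq (e here) h h′)) m

    selector : Σ (NRC (Tout ∷ Tin ∷ []) (set unit)) λ θ →
      (∀ i o a → Sat φ (i , o , a) → Holds θ (o , i , _)) ×
      (∀ i o a x → Sat φ (i , o , a) → Holds θ (x , i , _) → Eq Tout o x)
    selector = proj₁ result ,
      (λ i o a h → proj₁ (proj₂ result) (i , o , a) (fromSat φ h)) ,
      -- The right formula says that x differs from the output of the second copy. The selector
      -- excludes it, so an x satisfying the selector cannot differ from o.
      λ i o a x h p → stable λ n → proj₂ (proj₂ result) (x , i , o , a)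
        (fromSat φ h , λ e → n (Eq-sym Tout e)) p
      where
      rL : ∀ {T} → (Tout ∷ Tin ∷ []) ∋ T → (Tin ∷ Tout ∷ As) ∋ T
      rL here         = there here
      rL (there here) = here
      rR : ∀ {T} → (Tout ∷ Tin ∷ []) ∋ T → (Tout ∷ Tin ∷ Tout ∷ As) ∋ T
      rR here         = here
      rR (there here) = there here
      result = Sides.interpolation _ _ _ rL rR (fromΔ₀ φ) (and (wk (fromΔ₀ φ)) (neq (var here) (var (there (there here)))))
        λ (i , o , a) (x , i′ , o′ , a′) e h (h′ , n) →
          n (Eq-trans Tout (Eq-sym Tout (e here)) (implicit-Eq (e (there here)) h h′))

    explicit : Σ (NRC (Tin ∷ []) Tout) λ E → ∀ i o a → Sat φ (i , o , a) → Eval dflt E (i , _) o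
    explicit = get D , λ i o a h → ev D (i , _) , ev-self D (i , _) , inj₁ (o , singleton i o a h , Eq-refl Tout)
      where
      E = proj₁ candidates
      θ = proj₁ selector
      D = filter E θ
      singleton : ∀ i o a → Sat φ (i , o , a) → IsSingletonOf (ev D (i , _)) o
      singleton i o a h x =
        (λ p → let (z , _ , q , e) = filter-∈ E θ (i , _) (lower p) in
          Eq-trans Tout (proj₂ (proj₂ selector) i o a z h q) e) ,
        λ e → lift (proj₂ (ev D (i , _)) o x e
          (∈-filter E θ (i , _) (proj₂ candidates i o a h) (proj₁ (proj₂ selector) i o a h)))

theorem5p2 : ExcludedMiddle 0ℓ → ExcludedMiddle (lsuc 0ℓ) →
    (U : Set) → (ℕ ↣ U) → (dflt : (T : Ty) → Sem.⟦_⟧ U T) →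
    {Tin Tout : Ty} {As : List Ty} (φ : Δ₀ (Tin ∷ Tout ∷ As)) →
    Δ₀Sem.ImplicitlyDefines U φ →
    Σ (NRC (Tin ∷ []) Tout) (λ E →
    (i : Sem.⟦_⟧ U Tin) (o : Sem.⟦_⟧ U Tout) (a : Sem.Env U As) →
    Δ₀Sem.Sat U φ (i , o , a) →
    NRCEval.Eval U dflt E (i , _) o)
theorem5p2 em₀ em₁ U ι dflt φ implicit = Definability.explicit em₀ em₁ U ι dflt φ implicit
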